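{- Let $\mathcal{M}=\langle S,(S_i)_{i\in I},(\succeq_i)_{i\in I},R,V\rangle$ be a finite Trust model, $s\in S$, and $\alpha\in\mathcal{L}_T$. Let $n=|S|$, let $r$ be the number of pairs $(s,v)$ with $sRv$, let $k$ be the number of support subformulas (of the form $\varphi\rightsquigarrow\psi$) of $\alpha$, and let $k'$ be the number of belief modalities in $\alpha$ plus the number of atomic propositions in $\alpha$ plus the number of connectives in $\alpha$. Then whether $\mathcal{M},s\models\alpha$ can be decided with complexity $O(k\cdot n^2+(k+k')\cdot(n+r))$.
   Context: Propositional formulas: $\varphi::=\bot\mid p\mid\varphi\land\varphi\mid\varphi\lor\varphi\mid\varphi\to\varphi\mid\varphi\leftrightarrow\varphi\mid\neg\varphi$. $\mathcal{L}_T$: $\alpha::=\varphi\mid\varphi\rightsquigarrow\varphi\mid B(\alpha)\mid\alpha*\alpha\mid\neg\alpha$ ($\varphi$ propositional, $*\in\{\land,\lor,\to,\leftrightarrow\}$). A Trust model is $\mathcal{M}=\langle S,(S_i)_{i\in I},(\succeq_i)_{i\in I},R,V\rangle$: $R\subseteq S\times S$ serial and transitive; $(S_i)$ a partition of $S$; $\succeq_i\subseteq S_i\times S_i$ arbitrary; $V$ maps variables to subsets of $S$; and for each $i$ and propositional $\varphi$, $\|\varphi\|_i\neq\emptyset\Rightarrow\mathit{most}(\|\varphi\|_i)\neq\emptyset$, with $\|\varphi\|_i=\{v\in S_i:\mathcal{M},v\models\varphi\}$, $\mathit{most}(X)=\{s\in X:\forall v\in X\,(v\succeq_i s\Rightarrow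 s\succeq_i v)\}$. Truth: $s\models p$ iff $s\in V(p)$; Boolean clauses as usual; $s\models\varphi\rightsquigarrow\psi$ iff $\mathit{most}(\|\varphi\|_i)\subseteq\|\psi\|_i$ where $s\in S_i$; $s\models B(\alpha)$ iff $v\models\alpha$ for every $v$ with $sRv$. -}

module Defs where

open import Data.Bool using (if_then_else_)
open import Data.Empty using (⊥)
open import Data.Fin using (Fin; toℕ; remQuot)
open import Data.List using (List; []; _∷_; _++_; [_]; length; map; filter; tabulate; allFin; cartesianProduct)
open import Data.Nat using (ℕ; zero; suc; _+_; _*_; _∸_; _⊔_; _≡ᵇ_)
open import Data.Product using (∃; _×_; _,_; proj₁; proj₂; uncurry)
open import Data.Sum using (_⊎_)
open import Level using (0ℓ)
open import Relation.Binary using (Rel; Transitive; Decidable)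
open import Relation.Binary.PropositionalEquality using (_≡_; _≢_)
open import Relation.Nullary using (¬_; Dec; does)
open import Relation.Unary using (Pred; _∈_; _⊆_)

Var : Set
Var = ℕ

data Op : Set where
  and or imp iff : Op

infix 22 _⟨_⟩_
data Form : Set where
  bot   : Form
  var   : Var → Form
  _⟨_⟩_ : Form → Op → Form → Form
  neg   : Form → Form

infix 21 _⇝_
data TForm : Set where
  prop  : Form → TForm
  _⇝_   : Form → Form → TForm
  B     : TForm → TForm
  _⟨_⟩_ : TForm → Op → TForm → TForm
  neg   : TForm → TForm

-- All counts below are counts of occurrences.

atomsₚ : Form → ℕ
atomsₚ bot         = 0
atomsₚ (var p)     = 1
atomsₚ (φ ⟨ o ⟩ ψ) = atomsₚ φ + atomsₚ ψ
atomsₚ (neg φ)     = atomsₚ φ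

connectivesₚ : Form → ℕ
connectivesₚ bot         = 0
connectivesₚ (var p)     = 0
connectivesₚ (φ ⟨ o ⟩ ψ) = suc (connectivesₚ φ + connectivesₚ ψ)
connectivesₚ (neg φ)     = suc (connectivesₚ φ)

supports : TForm → ℕ
supports (prop φ)    = 0
supports (φ ⇝ ψ)     = 1
supports (B α)       = supports α
supports (α ⟨ o ⟩ β) = supports α + supports β
supports (neg α)     = supports α

beliefs : TForm → ℕ
beliefs (prop φ)    = 0
beliefs (φ ⇝ ψ)     = 0
beliefs (B α)       = suc (beliefs α)
beliefs (α ⟨ o ⟩ β) = beliefs α + beliefs β
beliefs (neg α)     = beliefs α

atoms : TForm → ℕ
atoms (prop φ)    = atomsₚ φ
atoms (φ ⇝ ψ)     = atomsₚ φ + atomsₚ ψ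
atoms (B α)       = atoms α
atoms (α ⟨ o ⟩ β) = atoms α + atoms β
atoms (neg α)     = atoms α

connectives : TForm → ℕ
connectives (prop φ)    = connectivesₚ φ
connectives (φ ⇝ ψ)     = connectivesₚ φ + connectivesₚ ψ
connectives (B α)       = connectives α
connectives (α ⟨ o ⟩ β) = suc (connectives α + connectives β)
connectives (neg α)     = suc (connectives α)

⟦_⟧ : Op → Set → Set → Set
⟦ and ⟧ X Y = X × Y
⟦ or  ⟧ X Y = X ⊎ Y
⟦ imp ⟧ X Y = X → Y
⟦ iff ⟧ X Y = (X → Y) × (Y → X)

module _ {S : Set} (V : Var → Pred S 0ℓ) where

  Trueₚ : S → Form → Set
  Trueₚ s bot         = ⊥
  Trueₚ s (var p)     = s ∈ V p
  Trueₚ s (φ ⟨ o ⟩ ψ) = ⟦ o ⟧ (Trueₚ s φ) (Trueₚ s ψ)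
  Trueₚ s (neg φ)     = ¬ Trueₚ s φ

record TrustModel (S I : Set) : Set₁ where
  field
    Cell   : I → Pred S 0ℓ
    _⪰[_]_ : S → I → S → Set
    R      : Rel S 0ℓ
    V      : Var → Pred S 0ℓ

    cell-nonempty : ∀ i → ∃ λ s → s ∈ Cell i
    cell-cover    : ∀ s → ∃ λ i → s ∈ Cell i
    cell-disjoint : ∀ {s i j} → s ∈ Cell i → s ∈ Cell j → i ≡ j

    ⪰-within : ∀ {i v s} → v ⪰[ i ] s → v ∈ Cell i × s ∈ Cell i

    R-serial     : ∀ s → ∃ λ v → R s v
    R-transitive : Transitive R

  ‖_‖ : Form → I → Pred S 0ℓ
  ‖ φ ‖ i v = v ∈ Cell i × Trueₚ V v φ

  most : I → Pred S 0ℓ → Pred S 0ℓ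
  most i X s = s ∈ X × (∀ v → v ∈ X → v ⪰[ i ] s → s ⪰[ i ] v)

  field
    smooth : ∀ i φ → (∃ λ s → s ∈ ‖ φ ‖ i) → ∃ λ s → s ∈ most i (‖ φ ‖ i)

  cellOf : S → I
  cellOf s = proj₁ (cell-cover s)

  infix 4 _⊨_
  _⊨_ : S → TForm → Set
  s ⊨ prop φ    = Trueₚ V s φ
  s ⊨ φ ⇝ ψ     = most (cellOf s) (‖ φ ‖ (cellOf s)) ⊆ ‖ ψ ‖ (cellOf s)
  s ⊨ B α       = ∀ v → R s v → v ⊨ α
  s ⊨ α ⟨ o ⟩ β = ⟦ o ⟧ (s ⊨ α) (s ⊨ β)
  s ⊨ neg α     = ¬ (s ⊨ α)

-- Cells are nonempty, so a partition of a finite set has a finite index set.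
-- The decidability fields hold classically for every finite model; here they
-- are what allows the model to be written down as input to an algorithm.
record FiniteTrustModel : Set₁ where
  field
    n m   : ℕ
    model : TrustModel (Fin n) (Fin m)

  open TrustModel model public

  field
    ⪰? : ∀ v i s → Dec (v ⪰[ i ] s)
    R? : Decidable R
    V? : ∀ p s → Dec (s ∈ V p)

  edges : List (Fin n × Fin n)
  edges = filter (λ (s , v) → R? s v) (cartesianProduct (allFin n) (allFin n))

  r : ℕ
  r = length edges

-- Random access machine with uniform cost.  A program uses finitely many
-- registers and finitely many unbounded arrays of natural numbers.
-- Multiplication is deliberately not a primitive: with it, unit-cost
-- arithmetic would be unreasonably powerful.

Reg Arr : Set
Reg = ℕ
Arr = ℕ

infixl 7 _⊕_ _⊖_
data Exp : Set where
  lit     : ℕ → Exp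
  reg     : Reg → Exp
  _⊕_ _⊖_ : Exp → Exp → Exp
  load    : Arr → Exp → Exp

infixr 3 _⨾_
data Prog : Set where
  skip   : Prog
  assign : Reg → Exp → Prog
  store  : Arr → Exp → Exp → Prog
  _⨾_    : Prog → Prog → Prog
  cond   : Exp → Prog → Prog → Prog
  while  : Exp → Prog → Prog

record State : Set where
  constructor mkState
  field
    regs : Reg → ℕ
    arrs : Arr → ℕ → ℕ
open State public

update : {X : Set} → (ℕ → X) → ℕ → X → ℕ → X
update f i x j = if i ≡ᵇ j then x else f j

eval : State → Exp → ℕ
eval σ (lit c)    = c
eval σ (reg x)    = regs σ x
eval σ (e ⊕ f)    = eval σ e + eval σ f
eval σ (e ⊖ f)    = eval σ e ∸ eval σ f
eval σ (load a e) = arrs σ a (eval σ e)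

cost : Exp → ℕ
cost (lit c)    = 1
cost (reg x)    = 1
cost (e ⊕ f)    = suc (cost e + cost f)
cost (e ⊖ f)    = suc (cost e + cost f)
cost (load a e) = suc (cost e)

setReg : State → Reg → ℕ → State
setReg (mkState ρ μ) x w = mkState (update ρ x w) μ

setArr : State → Arr → ℕ → ℕ → State
setArr (mkState ρ μ) a i w = mkState ρ (update μ a (update (μ a) i w))

-- c , σ ⇓ σ′ , t : started in σ, the program c halts in σ′ after t steps.
-- A test is passed when its value is nonzero.
infix 4 _,_⇓_,_
data _,_⇓_,_ : Prog → State → State → ℕ → Set where
  run-skip : ∀ {σ} → skip , σ ⇓ σ , 1
  run-assign : ∀ {σ x e} →
    assign x e , σ ⇓ setReg σ x (eval σ e) , suc (cost e)
  run-store : ∀ {σ a e f} →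
    store a e f , σ ⇓ setArr σ a (eval σ e) (eval σ f) , suc (cost e + cost f)
  run-seq : ∀ {c d σ σ′ σ″ t u} →
    c , σ ⇓ σ′ , t → d , σ′ ⇓ σ″ , u → (c ⨾ d) , σ ⇓ σ″ , suc (t + u)
  run-then : ∀ {e c d σ σ′ t} → eval σ e ≢ 0 →
    c , σ ⇓ σ′ , t → cond e c d , σ ⇓ σ′ , suc (cost e + t)
  run-else : ∀ {e c d σ σ′ t} → eval σ e ≡ 0 →
    d , σ ⇓ σ′ , t → cond e c d , σ ⇓ σ′ , suc (cost e + t)
  run-loop : ∀ {e c σ σ′ σ″ t u} → eval σ e ≢ 0 →
    c , σ ⇓ σ′ , t → while e c , σ′ ⇓ σ″ , u →
    while e c , σ ⇓ σ″ , suc (cost e + (t + u))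
  run-exit : ∀ {e c σ} → eval σ e ≡ 0 →
    while e c , σ ⇓ σ , suc (cost e)

opCode : Op → ℕ
opCode and = 2
opCode or  = 3
opCode imp = 4
opCode iff = 5

-- Formulas are written in reverse Polish notation.  The embedding prop leaves
-- no trace, so the two parses of a Boolean combination have the same code.

tokensₚ : Form → List ℕ
tokensₚ bot         = [ 0 ]
tokensₚ (var p)     = [ 8 + p ]
tokensₚ (φ ⟨ o ⟩ ψ) = tokensₚ φ ++ tokensₚ ψ ++ [ opCode o ]
tokensₚ (neg φ)     = tokensₚ φ ++ [ 1 ]

tokens : TForm → List ℕ
tokens (prop φ)    = tokensₚ φ
tokens (φ ⇝ ψ)     = tokensₚ φ ++ tokensₚ ψ ++ [ 6 ]
tokens (B α)       = tokens α ++ [ 7 ]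
tokens (α ⟨ o ⟩ β) = tokens α ++ tokens β ++ [ opCode o ]
tokens (neg α)     = tokens α ++ [ 1 ]

-- A strict upper bound on the variables of the formula.

varBoundₚ : Form → ℕ
varBoundₚ bot         = 0
varBoundₚ (var p)     = suc p
varBoundₚ (φ ⟨ o ⟩ ψ) = varBoundₚ φ ⊔ varBoundₚ ψ
varBoundₚ (neg φ)     = varBoundₚ φ

varBound : TForm → ℕ
varBound (prop φ)    = varBoundₚ φ
varBound (φ ⇝ ψ)     = varBoundₚ φ ⊔ varBoundₚ ψ
varBound (B α)       = varBound α
varBound (α ⟨ o ⟩ β) = varBound α ⊔ varBound β
varBound (neg α)     = varBound α

nth : List ℕ → ℕ → ℕ
nth []       i       = 0
nth (x ∷ xs) zero    = x
nth (x ∷ xs) (suc i) = nth xs i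

bit : {X : Set} → Dec X → ℕ
bit d = if does d then 1 else 0

-- Row-major: entry (i , j) is at position i * b + j.
table : (a b : ℕ) → (Fin a → Fin b → ℕ) → List ℕ
table a b f = tabulate {n = a * b} (λ k → uncurry f (remQuot b k))

module _ (M : FiniteTrustModel) where
  open FiniteTrustModel M

  -- registers: |S|, |R|, number of columns of the valuation table,
  -- evaluation state, length of the formula
  inputRegs : Fin n → TForm → List ℕ
  inputRegs s α = n ∷ r ∷ varBound α ∷ toℕ s ∷ length (tokens α) ∷ []

  -- R is given as a list of r pairs (arrays 1 and 2), the orders ⪰ᵢ as one
  -- n × n Boolean matrix (each relates only states of the same cell).
  inputArr : TForm → Arr → List ℕ
  inputArr α 0 = tokens α
  inputArr α 1 = map (λ e → toℕ (proj₁ e)) edges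
  inputArr α 2 = map (λ e → toℕ (proj₂ e)) edges
  inputArr α 3 = tabulate (λ s → toℕ (cellOf s))
  inputArr α 4 = table n n (λ v s → bit (⪰? v (cellOf v) s))
  inputArr α 5 = table n (varBound α) (λ s p → bit (V? (toℕ p) s))
  inputArr α _ = []

  input : Fin n → TForm → State
  input s α = mkState (nth (inputRegs s α)) (λ a → nth (inputArr α a))

-- The answer is read from register 0 on termination.
output : State → ℕ
output σ = regs σ 0

Decides : ℕ → Set → Set
Decides b X = (b ≡ 1 × X) ⊎ (b ≡ 0 × ¬ X)

{-# OPTIONS --safe #-}
module Submission where

-- The formula is evaluated bottom-up from its reverse Polish code, on a stack
-- whose entries are the truth values of a subformula at all n states.  A Boolean
-- token costs one pass over the states.  For B, a mark is set at every state and,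
-- in one pass over the edges, cleared at the source of each edge whose target
-- refutes the argument.  For φ ⇝ ψ a mark is set at every cell and cleared at the
-- cell of each state satisfying φ but not ψ that no state satisfying φ strictly
-- beats; testing this for all states takes n² steps.  The number of tokens is at
-- most 1 + 2 (k + k′), which is linear in k + k′ except for the formula ⊥.

open import Defs
open import Data.Bool using (true; false)
open import Data.Empty using (⊥; ⊥-elim)
open import Data.Fin using (Fin; toℕ; fromℕ<; combine; remQuot)
open import Data.Fin.Properties using (toℕ-injective; toℕ<n; toℕ-fromℕ<; toℕ-combine; remQuot-combine)
open import Data.List using (List; []; _∷_; _++_; [_]; length; map; tabulate; lookup; allFin; cartesianProduct)
open import Data.List.Membership.Propositional.Properties using (∈-filter⁺; ∈-filter⁻; ∈-cartesianProduct⁺; ∈-allFin; ∈-lookup)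
open import Data.List.Properties using (length-++)
open import Data.List.Relation.Unary.Any using (index)
open import Data.List.Relation.Unary.Any.Properties using (lookup-index)
open import Data.Nat using (ℕ; zero; suc; _+_; _*_; _∸_; _^_; _⊔_; _≤_; _<_; z≤n; s≤s; _≡ᵇ_)
open import Data.Nat.Properties
open import Data.Nat.Tactic.RingSolver using (solve-∀)
open import Data.Product using (∃; _×_; _,_; proj₁; proj₂; uncurry)
open import Data.Sum using (_⊎_; inj₁; inj₂)
open import Data.Unit using (⊤; tt)
open import Function using (_∘_; case_of_)
open import Relation.Binary.PropositionalEquality using (_≡_; _≢_; refl; sym; trans; cong; cong₂; subst)
open import Relation.Nullary using (¬_; Dec; yes; no; contradiction)
open import Relation.Nullary.Decidable using (decidable-stable)

-- Deciding bits

-- A formula is evaluated at all states at once because `B` and `⇝` at one state consult other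
-- states. The budget for a belief token is linear in n + r, which rules out searching an n × n
-- relation for the successors of each state; running over the edges and clearing marks at their
-- sources stays within it. The machine cannot multiply, so positions in row-major tables are
-- tracked by registers that advance by a whole row at each turn of a loop. Truth is a type and the
-- argument is constructive: every bit is tied to its formula by `Decides`, whose evidence supplies
-- the stability under double negation that implication, `B` and `⇝` require.

decides-map : ∀ {b X Y} → (X → Y) → (Y → X) → Decides b X → Decides b Y
decides-map f g (inj₁ (b≡1 , x))  = inj₁ (b≡1 , f x)
decides-map f g (inj₂ (b≡0 , ¬x)) = inj₂ (b≡0 , ¬x ∘ g)

decides-resp : ∀ {a b X} → a ≡ b → Decides b X → Decides a X
decides-resp refl d = d

decides-stable : ∀ {b X} → Decides b X → ¬ ¬ X → X
decides-stable (inj₁ (_ , x))  ¬¬x = x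
decides-stable (inj₂ (_ , ¬x)) ¬¬x = contradiction ¬x ¬¬x

decides-bit : ∀ {X} (d : Dec X) → Decides (bit d) X
decides-bit (yes x) = inj₁ (refl , x)
decides-bit (no ¬x) = inj₂ (refl , ¬x)

decides-¬ : ∀ {a X} → Decides a X → Decides (1 ∸ a) (¬ X)
decides-¬ (inj₁ (refl , x))  = inj₂ (refl , λ ¬x → ¬x x)
decides-¬ (inj₂ (refl , ¬x)) = inj₁ (refl , ¬x)

decides-× : ∀ {a b X Y} → Decides a X → Decides b Y → Decides (a + b ∸ 1) (X × Y)
decides-× (inj₁ (refl , x))  (inj₁ (refl , y))  = inj₁ (refl , x , y)
decides-× (inj₁ (refl , x))  (inj₂ (refl , ¬y)) = inj₂ (refl , ¬y ∘ proj₂)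
decides-× (inj₂ (refl , ¬x)) (inj₁ (refl , y))  = inj₂ (refl , ¬x ∘ proj₁)
decides-× (inj₂ (refl , ¬x)) (inj₂ (refl , ¬y)) = inj₂ (refl , ¬x ∘ proj₁)

-- On bits, truncated subtraction is "and not". Implications, beaten states, violations of a support
-- formula and the clearing of marks and flags all rest on it.
decides-×¬ : ∀ {a b X Y} → Decides a X → Decides b Y → Decides (a ∸ b) (X × ¬ Y)
decides-×¬ (inj₁ (refl , x))  (inj₁ (refl , y))  = inj₂ (refl , λ (_ , ¬y) → ¬y y)
decides-×¬ (inj₁ (refl , x))  (inj₂ (refl , ¬y)) = inj₁ (refl , x , ¬y)
decides-×¬ (inj₂ (refl , ¬x)) (inj₁ (refl , y))  = inj₂ (refl , ¬x ∘ proj₁)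
decides-×¬ (inj₂ (refl , ¬x)) (inj₂ (refl , ¬y)) = inj₂ (refl , ¬x ∘ proj₁)

-- The result must again be 0 or 1, as `Decides` admits no other value; subtracting twice from 1
-- caps the sum for a disjunction.
opExp : Op → Exp → Exp → Exp
opExp and x y = x ⊕ y ⊖ lit 1
opExp or  x y = lit 1 ⊖ (lit 1 ⊖ (x ⊕ y))
opExp imp x y = lit 1 ⊖ (x ⊖ y)
opExp iff x y = lit 1 ⊖ ((x ⊖ y) ⊕ (y ⊖ x))

decides-⊎ : ∀ {a b X Y} → Decides a X → Decides b Y → Decides (1 ∸ (1 ∸ (a + b))) (X ⊎ Y)
decides-⊎ (inj₁ (refl , x))  (inj₁ (refl , y))  = inj₁ (refl , inj₁ x)
decides-⊎ (inj₁ (refl , x))  (inj₂ (refl , ¬y)) = inj₁ (refl , inj₁ x)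
decides-⊎ (inj₂ (refl , ¬x)) (inj₁ (refl , y))  = inj₁ (refl , inj₂ y)
decides-⊎ (inj₂ (refl , ¬x)) (inj₂ (refl , ¬y)) = inj₂ (refl , λ { (inj₁ x) → ¬x x ; (inj₂ y) → ¬y y })

decides-→ : ∀ {a b X Y} → Decides a X → Decides b Y → Decides (1 ∸ (a ∸ b)) (X → Y)
decides-→ dx dy = decides-map
  -- The classical direction: it is available because `Y` is itself decided.
  (λ ¬[x×¬y] x → decides-stable dy (λ ¬y → ¬[x×¬y] (x , ¬y)))
  (λ x→y (x , ¬y) → ¬y (x→y x))
  (decides-¬ (decides-×¬ dx dy))

decides-↔ : ∀ {a b X Y} → Decides a X → Decides b Y →
            Decides (1 ∸ ((a ∸ b) + (b ∸ a))) ((X → Y) × (Y → X))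
decides-↔ (inj₁ (refl , x))  (inj₁ (refl , y))  = inj₁ (refl , (λ _ → y) , (λ _ → x))
decides-↔ (inj₁ (refl , x))  (inj₂ (refl , ¬y)) = inj₂ (refl , λ (x→y , _) → ¬y (x→y x))
decides-↔ (inj₂ (refl , ¬x)) (inj₁ (refl , y))  = inj₂ (refl , λ (_ , y→x) → ¬x (y→x y))
decides-↔ (inj₂ (refl , ¬x)) (inj₂ (refl , ¬y)) = inj₁ (refl , (λ x → ⊥-elim (¬x x)) , (λ y → ⊥-elim (¬y y)))

decides-op : ∀ o {x y τ X Y} → Decides (eval τ x) X → Decides (eval τ y) Y →
             Decides (eval τ (opExp o x y)) (⟦ o ⟧ X Y)
decides-op and = decides-×
decides-op or  = decides-⊎
decides-op imp = decides-→
decides-op iff = decides-↔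

-- Memory

update-at : ∀ {X : Set} (f : ℕ → X) {i j x} → i ≡ j → update f i x j ≡ x
update-at f {i} refl with i ≡ᵇ i | ≡⇒≡ᵇ i i refl
... | true | _ = refl

update-off : ∀ {X : Set} (f : ℕ → X) {i j x} → i ≢ j → update f i x j ≡ f j
update-off f {i} {j} i≢j with i ≡ᵇ j | ≡ᵇ⇒≡ i j
... | true  | eq = contradiction (eq tt) i≢j
... | false | _  = refl

nth-tabulate : ∀ {n} (f : Fin n → ℕ) k → nth (tabulate f) (toℕ k) ≡ f k
nth-tabulate f Fin.zero    = refl
nth-tabulate f (Fin.suc k) = nth-tabulate (f ∘ Fin.suc) k

nth-map : ∀ {A : Set} (f : A → ℕ) xs k → nth (map f xs) (toℕ k) ≡ f (lookup xs k)
nth-map f (x ∷ xs) Fin.zero    = refl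
nth-map f (x ∷ xs) (Fin.suc k) = nth-map f xs k

nth-table : ∀ {a b} (f : Fin a → Fin b → ℕ) i j → nth (table a b f) (toℕ i * b + toℕ j) ≡ f i j
nth-table {a} {b} f i j =
  trans (cong (nth (table a b f)) (trans (cong (_+ toℕ j) (*-comm (toℕ i) b)) (sym (toℕ-combine i j))))
        (trans (nth-tabulate (λ k → uncurry f (remQuot b k)) (combine i j))
               (cong (uncurry f) (remQuot-combine i j)))

-- Time-bounded total correctness

record Runs (c : Prog) (σ : State) (T : ℕ) (Q : State → Set) : Set where
  constructor halts
  field
    {final} : State
    {time}  : ℕ
    run     : c , σ ⇓ final , time
    time≤   : time ≤ T
    post    : Q final

runs-within : ∀ {c σ T U Q} → T ≤ U → Runs c σ T Q → Runs c σ U Q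
runs-within T≤U (halts run t≤T q) = halts run (≤-trans t≤T T≤U) q

runs-map : ∀ {c σ T Q Q′} → (∀ {τ} → Q τ → Q′ τ) → Runs c σ T Q → Runs c σ T Q′
runs-map f (halts run t≤T q) = halts run t≤T (f q)

runs-skip : ∀ {σ Q} → Q σ → Runs skip σ 1 Q
runs-skip = halts run-skip ≤-refl

runs-assign : ∀ {σ x e Q} → Q (setReg σ x (eval σ e)) → Runs (assign x e) σ (suc (cost e)) Q
runs-assign = halts run-assign ≤-refl

runs-store : ∀ {σ a e f Q} → Q (setArr σ a (eval σ e) (eval σ f)) →
             Runs (store a e f) σ (suc (cost e + cost f)) Q
runs-store = halts run-store ≤-refl

runs-seq : ∀ {c d σ T U P Q} → Runs c σ T P → (∀ {τ} → P τ → Runs d τ U Q) →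
           Runs (c ⨾ d) σ (suc (T + U)) Q
runs-seq (halts run₁ t≤T p) next with next p
... | halts run₂ u≤U q = halts (run-seq run₁ run₂) (s≤s (+-mono-≤ t≤T u≤U)) q

-- Pinning the intermediate state to the explicit successor lets the correctness of the remaining
-- program be proved by computing with that state.
runs-assign-seq : ∀ {d σ x e U Q} → Runs d (setReg σ x (eval σ e)) U Q →
                  Runs (assign x e ⨾ d) σ (suc (suc (cost e) + U)) Q
runs-assign-seq {σ = σ} {x} {e} next =
  runs-seq {P = λ τ → τ ≡ setReg σ x (eval σ e)} (runs-assign refl) λ { refl → next }

runs-store-seq : ∀ {d σ a e f U Q} → Runs d (setArr σ a (eval σ e) (eval σ f)) U Q →
                 Runs (store a e f ⨾ d) σ (suc (suc (cost e + cost f) + U)) Q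
runs-store-seq {σ = σ} {a} {e} {f} next =
  runs-seq {P = λ τ → τ ≡ setArr σ a (eval σ e) (eval σ f)} (runs-store refl) λ { refl → next }

runs-then : ∀ {e c d σ T Q} → eval σ e ≢ 0 → Runs c σ T Q → Runs (cond e c d) σ (suc (cost e + T)) Q
runs-then {e} nz (halts run t≤T q) = halts (run-then nz run) (s≤s (+-monoʳ-≤ (cost e) t≤T)) q

runs-else : ∀ {e c d σ T Q} → eval σ e ≡ 0 → Runs d σ T Q → Runs (cond e c d) σ (suc (cost e + T)) Q
runs-else {e} z (halts run t≤T q) = halts (run-else z run) (s≤s (+-monoʳ-≤ (cost e) t≤T)) q

runs-exit : ∀ {e c σ Q} → eval σ e ≡ 0 → Q σ → Runs (while e c) σ (suc (cost e)) Q
runs-exit z q = halts (run-exit z) ≤-refl q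

runs-loop : ∀ {e c σ T U P Q} → eval σ e ≢ 0 → Runs c σ T P → (∀ {τ} → P τ → Runs (while e c) τ U Q) →
            Runs (while e c) σ (suc (cost e + (T + U))) Q
runs-loop {e} nz (halts run₁ t≤T p) next with next p
... | halts run₂ u≤U q =
  halts (run-loop nz run₁ run₂) (s≤s (+-monoʳ-≤ (cost e) (+-mono-≤ t≤T u≤U))) q

forLoop : Reg → Reg → Prog → Prog
forLoop i b c = assign i (lit 0) ⨾ while (reg b ⊖ reg i) (c ⨾ assign i (reg i ⊕ lit 1))

module _ {i b : Reg} {c : Prog} {m T : ℕ} (Inv : ℕ → State → Set)
         (counts : ∀ {j τ} → Inv j τ → regs τ i ≡ j × regs τ b ≡ m)
         (body : ∀ (v : Fin m) {τ} → Inv (toℕ v) τ →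
                 Runs c τ T (λ ρ → Inv (suc (toℕ v)) (setReg ρ i (regs ρ i + 1))))
         where

  private
    loop-from : ∀ k {j τ} → j + k ≡ m → Inv j τ →
                Runs (while (reg b ⊖ reg i) (c ⨾ assign i (reg i ⊕ lit 1))) τ (4 + k * (9 + T)) (Inv m)
    loop-from zero {j} {τ} j+0≡m inv = runs-exit
      (trans (cong₂ _∸_ (proj₂ (counts inv)) (proj₁ (counts inv))) (m≤n⇒m∸n≡0 (≤-reflexive (sym j≡m))))
      (subst (λ k → Inv k τ) j≡m inv)
      where
      j≡m : j ≡ m
      j≡m = trans (sym (+-identityʳ j)) j+0≡m
    loop-from (suc k) {j} {τ} j+1+k≡m inv = runs-within
      (≤-reflexive (time T (k * (9 + T))))
      (runs-loop
        (subst (_≢ 0) (sym (cong₂ _∸_ (proj₂ (counts inv)) (proj₁ (counts inv)))) (m>n⇒m∸n≢0 j<m))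
        (runs-seq (body v (subst (λ k → Inv k τ) (sym v≡j) inv)) runs-assign)
        (λ {ρ} inv′ → loop-from k (trans (sym (+-suc j k)) j+1+k≡m) (subst (λ k → Inv (suc k) ρ) v≡j inv′)))
      where
      j<m : j < m
      j<m = subst (j <_) j+1+k≡m (m<m+n j (s≤s z≤n))
      v : Fin m
      v = fromℕ< j<m
      v≡j : toℕ v ≡ j
      v≡j = toℕ-fromℕ< j<m
      time : ∀ t u → suc (3 + (suc (t + 4) + (4 + u))) ≡ 4 + (9 + t + u)
      time = solve-∀

  -- Beyond its body an iteration pays 4 for the guard, 1 for sequencing and 4 for the increment;
  -- the 7 covers the initialisation and the final, failing guard.
  runs-for : ∀ {σ} → Inv 0 (setReg σ i 0) → Runs (forLoop i b c) σ (7 + m * (9 + T)) (Inv m)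
  runs-for inv = runs-assign-seq (loop-from m refl inv)

-- The program

-- Registers 0–4 and arrays 0–5 hold the input.  The truth values at all states
-- of a formula on the stack form a block of n consecutive bits.

pc top tok ptr idx base flag row col inner : Reg
pc    = 5
top   = 6
tok   = 7
ptr   = 8
idx   = 9
base  = 10
flag  = 11
row   = 12
col   = 13
inner = 14

stack marks : Arr
stack = 6
marks = 7

-- Advancing ptr by the number of columns walks down one column of the valuation.
fill : Exp → Prog
fill e = forLoop idx 0 (store stack (reg base ⊕ reg idx) e ⨾ assign ptr (reg ptr ⊕ reg 2))

mark : Exp → Prog
mark key = forLoop idx 0 (store marks key (lit 1))

-- Truncated subtraction clears a mark for good as soon as e evaluates to 1 once.
-- The register row follows the loop counter as its n-fold.
sieve : Reg → Prog → Exp → Exp → Prog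
sieve b c key e =
  assign row (lit 0) ⨾
  forLoop idx b (c ⨾ store marks key (load marks key ⊖ e) ⨾ assign row (reg row ⊕ reg 0))

first second : Exp
first  = load stack (reg base ⊕ reg idx)
second = load stack (reg base ⊕ reg idx ⊕ reg 0)

believe : Prog
believe =
  mark (reg idx) ⨾
  sieve 1 skip (load 1 (reg idx)) (lit 1 ⊖ load stack (reg base ⊕ load 2 (reg idx))) ⨾
  fill (load marks (reg idx))

-- For states v = idx and u = inner: u satisfies φ, u ⪰ v, and not v ⪰ u.
beaten : Exp
beaten = load stack (reg base ⊕ reg inner) ⊕ load 4 (reg col) ⊖ lit 1 ⊖ load 4 (reg row ⊕ reg inner)

-- While `col` walks down column `idx` of the order matrix, `row`, maintained by the surrounding
-- `sieve`, marks the start of row `idx`. Both directions of a comparison are thus read by additions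
-- alone.
maximal : Prog
maximal =
  assign flag (lit 1) ⨾
  assign col (reg idx) ⨾
  forLoop inner 0 (assign flag (reg flag ⊖ beaten) ⨾ assign col (reg col ⊕ reg 0))

support : Prog
support =
  mark (load 3 (reg idx)) ⨾
  sieve 0 maximal (load 3 (reg idx)) (first ⊕ reg flag ⊖ lit 1 ⊖ second) ⨾
  fill (load marks (load 3 (reg idx)))

-- Here `d` is the total length of the operand blocks, so the result is written from where the first
-- operand begins. All instructions share this shape, and `runs-step` treats them uniformly.
replacing : Exp → Prog → Prog
replacing d c = assign base (reg top ⊖ d) ⨾ c ⨾ assign top (reg base ⊕ reg 0)

binary : Op → Prog
binary o = replacing (reg 0 ⊕ reg 0) (fill (opExp o first second))

-- The position in the list is the token's code; codes from 8 on are variables.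
instructions : List Prog
instructions =
  replacing (lit 0) (fill (lit 0)) ∷
  replacing (reg 0) (fill (lit 1 ⊖ first)) ∷
  binary and ∷ binary or ∷ binary imp ∷ binary iff ∷
  replacing (reg 0 ⊕ reg 0) support ∷
  replacing (reg 0) believe ∷ []

variable-instruction : Prog
variable-instruction = replacing (lit 0) (assign ptr (reg tok ⊖ lit 8) ⨾ fill (load 5 (reg ptr)))

dispatch : ℕ → List Prog → Prog → Prog
dispatch i []       d = d
dispatch i (c ∷ cs) d = cond (reg tok ⊖ lit i) (dispatch (suc i) cs d) c

select : List Prog → Prog → ℕ → Prog
select []       d j       = d
select (c ∷ cs) d zero    = c
select (c ∷ cs) d (suc j) = select cs d j

instruction : ℕ → Prog
instruction = select instructions variable-instruction

step : Prog
step =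
  assign tok (load 0 (reg pc)) ⨾
  assign pc (reg pc ⊕ lit 1) ⨾
  dispatch 0 instructions variable-instruction

evaluate : Prog
evaluate = while (reg 4 ⊖ reg pc) step

-- The formula ⊥ is treated apart, since even one pass over the states
-- would exceed its constant time bound.
checker : Prog
checker =
  -- Codes are nonempty, so the test vanishes only when the code is the single token 0.
  cond (reg 4 ⊖ lit 1 ⊕ load 0 (lit 0))
    (assign pc (lit 0) ⨾ assign top (lit 0) ⨾ evaluate ⨾ assign 0 (load stack (reg 3)))
    (assign 0 (lit 0))

-- A vanishing `reg tok ⊖ lit i` says only that the token is at most `i`. Smaller codes have already
-- been excluded, as `i + j` records, so the test amounts to equality. Each test costs 4.
runs-dispatch : ∀ cs {d i j σ T Q} → regs σ tok ≡ i + j → Runs (select cs d j) σ T Q →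
                Runs (dispatch i cs d) σ (length cs * 4 + T) Q
runs-dispatch []       eq run = run
runs-dispatch (c ∷ cs) {i = i} {zero} {T = T} eq run = runs-within
  (+-monoʳ-≤ 4 (m≤n+m T (length cs * 4)))
  (runs-else (trans (cong (_∸ i) eq) (m≤n⇒m∸n≡0 (≤-reflexive (+-identityʳ i)))) run)
runs-dispatch (c ∷ cs) {i = i} {suc j} {σ} eq run =
  runs-then (subst (λ k → k ∸ i ≢ 0) (sym eq) (subst (_≢ 0) (sym (m+n∸m≡n i (suc j))) λ ()))
            (runs-dispatch cs (trans eq (+-suc i j)) run)

-- Preservation of part of a state is an equation between such snapshots; for
-- assignments and stores elsewhere it holds by refl, so no extensionality is needed.

record Inputs : Set where
  constructor mkInputs
  field
    states arrows columns start size : ℕ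
    program source target cells order valuation : ℕ → ℕ

inputs : State → Inputs
inputs σ = mkInputs (regs σ 0) (regs σ 1) (regs σ 2) (regs σ 3) (regs σ 4)
                    (arrs σ 0) (arrs σ 1) (arrs σ 2) (arrs σ 3) (arrs σ 4) (arrs σ 5)

record Kept : Set where
  constructor mkKept
  field
    given               : Inputs
    pcᵏ topᵏ tokᵏ baseᵏ : ℕ

kept : State → Kept
kept σ = mkKept (inputs σ) (regs σ pc) (regs σ top) (regs σ tok) (regs σ base)

record Outer : Set where
  constructor mkOuter
  field
    keptᵒ         : Kept
    idxᵒ rowᵒ     : ℕ
    stackᵒ marksᵒ : ℕ → ℕ

outer : State → Outer
outer σ = mkOuter (kept σ) (regs σ idx) (regs σ row) (arrs σ stack) (arrs σ marks)

open Inputs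
open Kept
open Outer

<-suc-split : ∀ {m} {w v : Fin m} → toℕ w < suc (toℕ v) → toℕ w < toℕ v ⊎ w ≡ v
<-suc-split w<1+v with m<1+n⇒m<n∨m≡n w<1+v
... | inj₁ w<v = inj₁ w<v
... | inj₂ w≡v = inj₂ (toℕ-injective w≡v)

-- Loops over the states of a fixed input

module Evaluation (M : FiniteTrustModel) (s₀ : Fin (FiniteTrustModel.n M)) (α₀ : TForm) where
  open FiniteTrustModel M

  Ready : State → Set
  Ready σ = inputs σ ≡ inputs (input M s₀ α₀)

  columns₀ : ℕ
  columns₀ = varBound α₀

  Holds : State → ℕ → (Fin n → Set) → Set
  Holds σ b X = ∀ v → Decides (arrs σ stack (b + toℕ v)) (X v)

  SameBelow : ℕ → State → State → Set
  SameBelow b σ τ = ∀ x → x < b → arrs τ stack x ≡ arrs σ stack x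

  record Computed (σ : State) (X : Fin n → Set) (τ : State) : Set where
    constructor computed
    field
      keeps : kept τ ≡ kept σ
      holds : Holds τ (regs σ base) X
      below : SameBelow (regs σ base) σ τ

  computed-from : ∀ {σ ρ τ X} → kept ρ ≡ kept σ → arrs ρ stack ≡ arrs σ stack →
                  Computed ρ X τ → Computed σ X τ
  computed-from {τ = τ} keeps′ stacked (computed keeps holds below) = computed
    (trans keeps keeps′)
    (subst (λ b → Holds τ b _) (cong baseᵏ keeps′) holds)
    (λ x x<b → trans (below x (subst (x <_) (sym (cong baseᵏ keeps′)) x<b)) (cong (λ a → a x) stacked))

  ready-kept : ∀ {k l} → given l ≡ inputs (input M s₀ α₀) → k ≡ l → given k ≡ inputs (input M s₀ α₀)
  ready-kept ready keeps = trans (cong given keeps) ready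

  module _ {σ : State} (ready : Ready σ) where

    -- The result overwrites the first operand in place: `above` keeps the operand entries not yet
    -- reached readable, and `below` protects the rest of the stack.
    record Filling (X : Fin n → Set) (j : ℕ) (τ : State) : Set where
      constructor filling
      field
        keeps   : kept τ ≡ kept σ
        counter : regs τ idx ≡ j
        pointer : regs τ ptr ≡ regs σ ptr + j * columns₀
        marked  : arrs τ marks ≡ arrs σ marks
        done    : ∀ v → toℕ v < j → Decides (arrs τ stack (regs σ base + toℕ v)) (X v)
        below   : SameBelow (regs σ base) σ τ
        above   : ∀ x → regs σ base + j ≤ x → arrs τ stack x ≡ arrs σ stack x

    -- The bound 25 is the cost of the biconditional in `opExp`, the dearest expression used here;
    -- loop overhead, store and pointer update raise it to 43.
    runs-fill : ∀ {X e} → cost e ≤ 25 →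
                (∀ v {τ} → Filling X (toℕ v) τ → Decides (eval τ e) (X v)) →
                Runs (fill e) σ (7 + n * 43) (Computed σ X)
    runs-fill {X} {e} cheap value = runs-within
      (+-monoʳ-≤ 7 (*-monoʳ-≤ n time))
      (runs-map
        (λ f → let open Filling f in computed keeps (λ v → done v (toℕ<n v)) below)
        (runs-for (Filling X)
          (λ f → Filling.counter f , cong states (ready-kept ready (Filling.keeps f)))
          body
          (filling refl refl (sym (+-identityʳ _)) refl (λ v ()) (λ _ _ → refl) (λ _ _ → refl))))
      where
      time : 9 + suc (suc (3 + cost e) + 4) ≤ 43
      time = +-monoʳ-≤ 14 (≤-trans (≤-reflexive (+-comm (cost e) 4)) (+-monoʳ-≤ 4 cheap))
      body : ∀ v {τ} → Filling X (toℕ v) τ →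
             Runs (store stack (reg base ⊕ reg idx) e ⨾ assign ptr (reg ptr ⊕ reg 2)) τ
                  (suc (suc (3 + cost e) + 4))
                  (λ ρ → Filling X (suc (toℕ v)) (setReg ρ idx (regs ρ idx + 1)))
      body v {τ} f = runs-store-seq (runs-assign (filling keeps
        (trans (+-comm _ 1) (cong suc counter))
        (trans (cong₂ _+_ pointer (cong columns (ready-kept ready keeps)))
               (trans (+-assoc (regs σ ptr) _ _) (cong (regs σ ptr +_) (+-comm _ columns₀))))
        marked
        done′
        (λ x x<b → trans (update-off (arrs τ stack)
                           (λ i≡x → <⇒≱ x<b (subst (regs σ base ≤_) (trans (sym at) i≡x) (m≤m+n _ _))))
                         (below x x<b))
        (λ x b+1+v≤x → let b+v<x = subst (_≤ x) (+-suc (regs σ base) (toℕ v)) b+1+v≤x in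
          trans (update-off (arrs τ stack) (λ i≡x → <⇒≢ b+v<x (trans (sym at) i≡x))) (above x (<⇒≤ b+v<x)))))
        where
        open Filling f
        at : regs τ base + regs τ idx ≡ regs σ base + toℕ v
        at = cong₂ _+_ (cong baseᵏ keeps) counter
        done′ : ∀ w → toℕ w < suc (toℕ v) →
                Decides (update (arrs τ stack) (regs τ base + regs τ idx) (eval τ e) (regs σ base + toℕ w)) (X w)
        done′ w w<1+v with <-suc-split w<1+v
        ... | inj₂ refl = decides-resp (update-at (arrs τ stack) at) (value v f)
        ... | inj₁ w<v  = decides-resp
          (update-off (arrs τ stack) (λ i≡w → <⇒≢ w<v (+-cancelˡ-≡ (regs σ base) _ _ (sym (trans (sym at) i≡w)))))
          (done w w<v)

    record Marking (key : Fin n → ℕ) (j : ℕ) (τ : State) : Set where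
      constructor marking
      field
        keeps   : kept τ ≡ kept σ
        counter : regs τ idx ≡ j
        stacked : arrs τ stack ≡ arrs σ stack
        marked  : ∀ v → toℕ v < j → arrs τ marks (key v) ≡ 1

    runs-mark : ∀ {key e} → cost e ≤ 2 →
                (∀ v {τ} → kept τ ≡ kept σ → regs τ idx ≡ toℕ v → eval τ e ≡ key v) →
                Runs (mark e) σ (7 + n * 13) (Marking key n)
    runs-mark {key} {e} cheap at = runs-within
      (+-monoʳ-≤ 7 (*-monoʳ-≤ n (+-monoʳ-≤ 10 (≤-trans (≤-reflexive (+-comm (cost e) 1)) (+-monoʳ-≤ 1 cheap)))))
      (runs-for (Marking key)
        (λ m → Marking.counter m , cong states (ready-kept ready (Marking.keeps m)))
        (λ v m → let open Marking m in
          runs-store (marking keeps (trans (+-comm _ 1) (cong suc counter)) stacked (marked′ v m)))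
        (marking refl refl refl (λ v ())))
      where
      marked′ : ∀ v {τ} → Marking key (toℕ v) τ → ∀ w → toℕ w < suc (toℕ v) →
                update (arrs τ marks) (eval τ e) 1 (key w) ≡ 1
      -- Distinct states may share a key, so the case split is on the address written to.
      marked′ v {τ} m w w<1+v with eval τ e ≟ key w | <-suc-split w<1+v
      ... | yes hit | _         = update-at (arrs τ marks) hit
      ... | no miss | inj₁ w<v  = trans (update-off (arrs τ marks) miss) (Marking.marked m w w<v)
      ... | no miss | inj₂ refl = contradiction (at v (Marking.keeps m) (Marking.counter m)) miss

    -- Only addresses holding 1 at the start are described: elsewhere `marks` may contain remains of
    -- earlier tokens. The index runs over edges for `B` and over states for `⇝`.
    record Sieving {m : ℕ} (key : Fin m → ℕ) (Bad : Fin m → Set) (j : ℕ) (τ : State) : Set where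
      constructor sieving
      field
        keeps   : kept τ ≡ kept σ
        counter : regs τ idx ≡ j
        rowed   : regs τ row ≡ j * n
        stacked : arrs τ stack ≡ arrs σ stack
        sieved  : ∀ x → arrs σ marks x ≡ 1 →
                  Decides (arrs τ marks x) (∀ w → toℕ w < j → key w ≡ x → ¬ Bad w)

    runs-sieve : ∀ {m b c T k e} {key : Fin m → ℕ} {Bad : Fin m → Set} →
      (∀ τ → kept τ ≡ kept σ → regs τ b ≡ m) →
      (∀ v {τ} → Sieving key Bad (toℕ v) τ →
        Runs c τ T (λ ρ → outer ρ ≡ outer τ × eval ρ k ≡ key v × Decides (eval ρ e) (Bad v))) →
      Runs (sieve b c k e) σ
        (10 + m * (9 + suc (T + suc (suc (cost k + suc (suc (cost k) + cost e)) + 4))))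
        (Sieving key Bad m)
    runs-sieve {k = k} {e} {key} {Bad} bound test = runs-assign-seq
      (runs-for (Sieving key Bad)
        (λ {_} {τ} s → Sieving.counter s , bound τ (Sieving.keeps s))
        (λ v {τ} s → let open Sieving s in
          runs-seq (test v s) λ {ρ} (same , at , bad) →
          runs-store-seq (runs-assign (sieving
            (trans (cong keptᵒ same) keeps)
            (trans (+-comm _ 1) (cong suc (trans (cong idxᵒ same) counter)))
            (trans (cong₂ _+_ (trans (cong rowᵒ same) rowed)
                              (cong states (ready-kept ready (trans (cong keptᵒ same) keeps))))
                   (+-comm _ n))
            (trans (cong stackᵒ same) stacked)
            (sieved′ v s same at bad))))
        (sieving refl refl refl refl (λ x x≡1 → inj₁ (x≡1 , λ w ()))))
      where
      sieved′ : ∀ v {τ ρ} → Sieving key Bad (toℕ v) τ → outer ρ ≡ outer τ → eval ρ k ≡ key v →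
                Decides (eval ρ e) (Bad v) → ∀ x → arrs σ marks x ≡ 1 →
                Decides (update (arrs ρ marks) (eval ρ k) (arrs ρ marks (eval ρ k) ∸ eval ρ e) x)
                        (∀ w → toℕ w < suc (toℕ v) → key w ≡ x → ¬ Bad w)
      sieved′ v {τ} {ρ} s same at bad x x≡1 with eval ρ k ≟ x
      ... | yes hit = decides-map
        (λ (old , ¬bad) w w<1+v key≡x → case <-suc-split w<1+v of λ
          { (inj₁ w<v) → old w w<v key≡x ; (inj₂ refl) → ¬bad })
        (λ all → (λ w w<v → all w (m<n⇒m<1+n w<v)) , all v (n<1+n _) (trans (sym at) hit))
        (decides-resp
          (trans (update-at (arrs ρ marks) hit) (cong (_∸ eval ρ e) (cong₂ (λ f i → f i) (cong marksᵒ same) hit)))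
          (decides-×¬ (Sieving.sieved s x x≡1) bad))
      ... | no miss = decides-map
        (λ old w w<1+v key≡x → case <-suc-split w<1+v of λ
          { (inj₁ w<v) → old w w<v key≡x ; (inj₂ refl) → contradiction (trans at key≡x) miss })
        (λ all w w<v → all w (m<n⇒m<1+n w<v))
        (decides-resp (trans (update-off (arrs ρ marks) miss) (cong (λ f → f x) (cong marksᵒ same))) (Sieving.sieved s x x≡1))

    element-index : ∀ (v : Fin n) τ → kept τ ≡ kept σ → regs τ idx ≡ toℕ v →
                    regs τ base + regs τ idx ≡ regs σ base + toℕ v
    element-index v τ keeps counter = cong₂ _+_ (cong baseᵏ keeps) counter

    next-element-index : ∀ (v : Fin n) τ → kept τ ≡ kept σ → regs τ idx ≡ toℕ v →
                         regs τ base + regs τ idx + regs τ 0 ≡ regs σ base + n + toℕ v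
    next-element-index v τ keeps counter =
      trans (cong₂ _+_ (element-index v τ keeps counter) (cong states (ready-kept ready keeps)))
            (trans (+-assoc (regs σ base) (toℕ v) n)
                   (trans (cong (regs σ base +_) (+-comm (toℕ v) n)) (sym (+-assoc (regs σ base) n (toℕ v)))))

    decides-first : ∀ {X Y} v {τ} → Holds σ (regs σ base) Y → Filling X (toℕ v) τ →
                    Decides (eval τ first) (Y v)
    decides-first v {τ} holds f = decides-resp
      (trans (cong (arrs τ stack) (element-index v τ keeps counter)) (above _ ≤-refl)) (holds v)
      where open Filling f

    decides-second : ∀ {X Y} v {τ} → Holds σ (regs σ base + n) Y → Filling X (toℕ v) τ →
                     Decides (eval τ second) (Y v)
    decides-second v {τ} holds f = decides-resp
      (trans (cong (arrs τ stack) (next-element-index v τ keeps counter))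
             (above _ (+-monoˡ-≤ (toℕ v) (m≤m+n (regs σ base) n))))
      (holds v)
      where open Filling f

    runs-falsum : Runs (fill (lit 0)) σ (7 + n * 43) (Computed σ (λ _ → ⊥))
    runs-falsum = runs-fill (≤ᵇ⇒≤ _ _ tt) (λ _ _ → inj₂ (refl , λ ()))

    runs-negation : ∀ {X} → Holds σ (regs σ base) X →
                    Runs (fill (lit 1 ⊖ first)) σ (7 + n * 43) (Computed σ (λ v → ¬ X v))
    runs-negation holds = runs-fill (≤ᵇ⇒≤ _ _ tt) (λ v f → decides-¬ (decides-first v holds f))

    runs-operation : ∀ o {X Y} → Holds σ (regs σ base) X → Holds σ (regs σ base + n) Y →
                     Runs (fill (opExp o first second)) σ (7 + n * 43) (Computed σ (λ v → ⟦ o ⟧ (X v) (Y v)))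
    runs-operation o holdsX holdsY = runs-fill (cheap o)
      (λ v {τ} f → decides-op o {first} {second} {τ} (decides-first v holdsX f) (decides-second v holdsY f))
      where
      cheap : ∀ o → cost (opExp o first second) ≤ 25
      cheap and = ≤ᵇ⇒≤ _ _ tt
      cheap or  = ≤ᵇ⇒≤ _ _ tt
      cheap imp = ≤ᵇ⇒≤ _ _ tt
      cheap iff = ≤ᵇ⇒≤ _ _ tt

  -- Variables and belief

  runs-variable : ∀ {p σ} → Ready σ → p < columns₀ → regs σ tok ≡ 8 + p →
                  Runs (assign ptr (reg tok ⊖ lit 8) ⨾ fill (load 5 (reg ptr))) σ (12 + n * 43)
                       (Computed σ (V p))
  runs-variable {p} {σ} ready p<columns tok≡ = runs-assign-seq (runs-map
    (computed-from refl refl)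
    (runs-fill ready (≤ᵇ⇒≤ _ _ tt) λ v {τ} f → let open Filling f in decides-resp
      (trans (cong₂ (λ a i → a i) (cong valuation (ready-kept ready keeps)) (trans pointer (at v)))
             (nth-table (λ s q → bit (V? (toℕ q) s)) v (fromℕ< p<columns)))
      (subst (λ q → Decides (bit (V? q v)) (V p v)) (sym (toℕ-fromℕ< p<columns)) (decides-bit (V? p v)))))
    where
    at : ∀ v → regs σ tok ∸ 8 + toℕ v * columns₀ ≡ toℕ v * columns₀ + toℕ (fromℕ< p<columns)
    at v = trans (+-comm _ (toℕ v * columns₀))
                 (cong (toℕ v * columns₀ +_) (trans (cong (_∸ 8) tok≡) (sym (toℕ-fromℕ< p<columns))))

  runs-belief : ∀ {X σ} → Ready σ → Holds σ (regs σ base) X →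
                Runs believe σ (26 + n * 56 + r * 30) (Computed σ (λ s → ∀ v → R s v → X v))
  runs-belief {X} {σ} ready holds = runs-within (≤-reflexive (time n r))
    (runs-seq (runs-mark ready {key = toℕ} (≤ᵇ⇒≤ _ _ tt) (λ _ _ counter → counter)) λ {τ₁} m →
     let ready₁ = ready-kept ready (Marking.keeps m) in
     runs-seq (runs-sieve ready₁ {key = source′} {Bad = λ j → ¬ X (proj₂ (lookup edges j))}
       (λ _ keeps → cong arrows (ready-kept ready₁ keeps))
       (λ j s → let open Sieving s; ready′ = ready-kept ready₁ keeps in runs-skip
         ( refl
         , trans (cong₂ (λ a i → a i) (cong source ready′) counter) (nth-map (toℕ ∘ proj₁) edges j)
         , decides-¬ (decides-resp
             (cong₂ (λ a i → a i) (trans stacked (Marking.stacked m))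
               (cong₂ _+_ (cong baseᵏ (trans keeps (Marking.keeps m)))
                 (trans (cong₂ (λ a i → a i) (cong target ready′) counter) (nth-map (toℕ ∘ proj₂) edges j))))
             (holds (proj₂ (lookup edges j))))))) λ {τ₂} s →
     let ready₂ = ready-kept ready₁ (Sieving.keeps s)
         keeps₂ = trans (Sieving.keeps s) (Marking.keeps m)
         stacked₂ = trans (Sieving.stacked s) (Marking.stacked m) in
     runs-map
       (computed-from keeps₂ stacked₂)
       (runs-fill ready₂ (≤ᵇ⇒≤ _ _ tt) λ v f → let open Filling f in decides-map
         -- A surviving mark yields only that no successor refutes the argument; the bits on the
         -- stack already decide the argument there.
         (λ all w vRw → decides-stable (holds w) (sound all vRw))
         (λ all j _ source≡v ¬X → ¬X (all _ (edge j source≡v)))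
         (decides-resp (cong₂ (λ a i → a i) marked counter) (Sieving.sieved s (toℕ v) (Marking.marked m v (toℕ<n v))))))
    where
    source′ : Fin r → ℕ
    source′ j = toℕ (proj₁ (lookup edges j))
    time : ∀ n r → suc (7 + n * 13 + suc (10 + r * 30 + (7 + n * 43))) ≡ 26 + n * 56 + r * 30
    time = solve-∀
    edge : ∀ {v} j → source′ j ≡ toℕ v → R v (proj₂ (lookup edges j))
    edge j source≡v = subst (λ u → R u _) (toℕ-injective source≡v)
      (proj₂ (∈-filter⁻ (λ (s , v) → R? s v) {xs = cartesianProduct (allFin n) (allFin n)} (∈-lookup {xs = edges} j)))
    sound : ∀ {v w} → (∀ j → toℕ j < r → source′ j ≡ toℕ v → ¬ ¬ X (proj₂ (lookup edges j))) → R v w → ¬ ¬ X w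
    sound {v} {w} all vRw =
      subst (λ e → ¬ ¬ X (proj₂ e)) (sym found) (all (index edge∈) (toℕ<n _) (cong (toℕ ∘ proj₁) (sym found)))
      where
      edge∈ = ∈-filter⁺ (λ (s , v) → R? s v) (∈-cartesianProduct⁺ (∈-allFin v) (∈-allFin w)) vRw
      found = lookup-index edge∈

  -- Maximal states and the support operator

  record Surveying (σ : State) (Beats : Fin n → Set) (v : Fin n) (j : ℕ) (τ : State) : Set where
    constructor surveying
    field
      same    : outer τ ≡ outer σ
      counter : regs τ inner ≡ j
      column  : regs τ col ≡ toℕ v + j * n
      flagged : Decides (regs τ flag) (∀ u → toℕ u < j → ¬ Beats u)

  -- Each comparison is taken in the cell of its left-hand state, exactly as the order matrix is
  -- laid out.
  Beats : (Fin n → Set) → Fin n → Fin n → Set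
  Beats X v u = (X u × u ⪰[ cellOf u ] v) × ¬ (v ⪰[ cellOf v ] u)

  runs-maximal : ∀ {X σ} v → Ready σ → Holds σ (regs σ base) X → regs σ idx ≡ toℕ v → regs σ row ≡ toℕ v * n →
                 Runs maximal σ (13 + n * 31) (λ τ → outer τ ≡ outer σ × Decides (regs τ flag) (∀ u → ¬ Beats X v u))
  runs-maximal {X} {σ} v ready holds counter₀ row₀ = runs-assign-seq (runs-assign-seq (runs-map
    (λ s → let open Surveying s in
      same , decides-map (λ all u → all u (toℕ<n u)) (λ all u _ → all u) flagged)
    (runs-for (Surveying σ (Beats X v) v)
      (λ s → Surveying.counter s , cong states (ready′ s))
      (λ u {τ} s → let open Surveying s in runs-assign-seq (runs-assign (surveying
        same
        (trans (+-comm _ 1) (cong suc counter))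
        (trans (cong₂ _+_ column (cong states (ready′ s)))
               (trans (+-assoc (toℕ v) _ n) (cong (toℕ v +_) (+-comm _ n))))
        (decides-map
          (λ (old , ¬beats) w w<1+u → case <-suc-split w<1+u of λ { (inj₁ w<u) → old w w<u ; (inj₂ refl) → ¬beats })
          (λ all → (λ w w<u → all w (m<n⇒m<1+n w<u)) , all u (n<1+n _))
          (decides-×¬ flagged (decides-beaten u s))))))
      (surveying refl refl (trans counter₀ (sym (+-identityʳ _))) (inj₁ (refl , λ u ()))))))
    where
    ready′ : ∀ {j τ} → Surveying σ (Beats X v) v j τ → inputs τ ≡ inputs (input M s₀ α₀)
    ready′ s = ready-kept ready (cong keptᵒ (Surveying.same s))
    decides-beaten : ∀ u {τ} → Surveying σ (Beats X v) v (toℕ u) τ → Decides (eval τ beaten) (Beats X v u)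
    decides-beaten u s = decides-×¬
      (decides-×
        (decides-resp (cong₂ (λ a i → a i) (cong stackᵒ same) (cong₂ _+_ (cong (baseᵏ ∘ keptᵒ) same) counter)) (holds u))
        (decides-resp
          (trans (cong₂ (λ a i → a i) (cong order (ready′ s)) (trans column (+-comm (toℕ v) _))) (nth-table entry u v))
          (decides-bit (⪰? u (cellOf u) v))))
      (decides-resp
        (trans (cong₂ (λ a i → a i) (cong order (ready′ s)) (cong₂ _+_ (trans (cong rowᵒ same) row₀) counter))
               (nth-table entry v u))
        (decides-bit (⪰? v (cellOf v) u)))
      where
      open Surveying s
      entry : Fin n → Fin n → ℕ
      entry v s = bit (⪰? v (cellOf v) s)

  cellOf-unique : ∀ {v i} → Cell i v → cellOf v ≡ i
  cellOf-unique {v} v∈i = cell-disjoint (proj₂ (cell-cover v)) v∈i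

  -- By `⪰-within` a state is comparable only to members of its own cell, so being unbeaten among
  -- all states satisfying `φ` coincides with maximality inside the cell.
  supports-if-none-violates : ∀ φ ψ s → (∀ v → ¬ ¬ Trueₚ V v ψ → Trueₚ V v ψ) →
    (∀ v → toℕ (cellOf v) ≡ toℕ (cellOf s) →
      ¬ ((Trueₚ V v φ × (∀ u → ¬ Beats (λ u → Trueₚ V u φ) v u)) × ¬ Trueₚ V v ψ)) →
    s ⊨ φ ⇝ ψ
  supports-if-none-violates φ ψ s stable none {v} ((v∈c , φv) , maximal-v) =
    v∈c , stable v λ ¬ψv → none v (cong toℕ (cellOf-unique v∈c)) ((φv , unbeaten) , ¬ψv)
    where
    unbeaten : ∀ u → ¬ Beats (λ u → Trueₚ V u φ) v u
    unbeaten u ((φu , u⪰v) , ¬v⪰u) = ¬v⪰u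
      (subst (λ i → v ⪰[ i ] u) (sym (cellOf-unique v∈c))
        (maximal-v u (proj₁ (⪰-within u⪰ᶜv) , φu) u⪰ᶜv))
      where
      u⪰ᶜv : u ⪰[ cellOf s ] v
      u⪰ᶜv = subst (λ i → u ⪰[ i ] v) (cell-disjoint (proj₂ (⪰-within u⪰v)) v∈c) u⪰v

  none-violates-if-supports : ∀ φ ψ s → s ⊨ φ ⇝ ψ →
    ∀ v → toℕ (cellOf v) ≡ toℕ (cellOf s) →
      ¬ ((Trueₚ V v φ × (∀ u → ¬ Beats (λ u → Trueₚ V u φ) v u)) × ¬ Trueₚ V v ψ)
  none-violates-if-supports φ ψ s most⊆ψ v same ((φv , unbeaten) , ¬ψv) =
    ¬ψv (proj₂ (most⊆ψ ((v∈c , φv) , λ u (u∈c , φu) u⪰v →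
      -- Being unbeaten refutes only the failure of the converse comparison; decidability of the
      -- order recovers the comparison itself.
      decidable-stable (⪰? v (cellOf s) u) λ ¬v⪰u →
        unbeaten u ( (φu , subst (λ i → u ⪰[ i ] v) (sym (cellOf-unique u∈c)) u⪰v)
                   , λ v⪰u → ¬v⪰u (subst (λ i → v ⪰[ i ] u) cell≡ v⪰u)))))
    where
    cell≡ : cellOf v ≡ cellOf s
    cell≡ = toℕ-injective same
    v∈c : Cell (cellOf s) v
    v∈c = subst (λ i → Cell i v) cell≡ (proj₂ (cell-cover v))

  -- The truth value depends on a state only through its cell, so one mark per cell suffices and
  -- each state is tested for maximality once. That test is the only source of the quadratic term.
  runs-support : ∀ φ ψ {σ} → Ready σ → Holds σ (regs σ base) (λ v → Trueₚ V v φ) →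
                 Holds σ (regs σ base + n) (λ v → Trueₚ V v ψ) →
                 Runs support σ (26 + n * 106 + n * (n * 31)) (Computed σ (λ s → s ⊨ φ ⇝ ψ))
  runs-support φ ψ {σ} ready holdsφ holdsψ = runs-within (≤-reflexive (time n))
    (runs-seq (runs-mark ready {key = cell} (≤ᵇ⇒≤ _ _ tt)
       (λ v {τ} keeps counter → cell-at v τ (ready-kept ready keeps) counter)) λ {τ₁} m →
     let ready₁ = ready-kept ready (Marking.keeps m) in
     runs-seq (runs-sieve ready₁ {key = cell}
         {Bad = λ v → (Trueₚ V v φ × (∀ u → ¬ Beats (λ u → Trueₚ V u φ) v u)) × ¬ Trueₚ V v ψ}
       (λ _ keeps → cong states (ready-kept ready₁ keeps))
       (λ v {τ} s → let open Sieving s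
                        keeps₁ = trans keeps (Marking.keeps m)
                        stacked₁ = trans stacked (Marking.stacked m) in
         runs-map (λ {ρ} (same , flagged) →
             let keeps′ = trans (cong keptᵒ same) keeps₁
                 counter′ = trans (cong idxᵒ same) counter
                 stacked′ = trans (cong stackᵒ same) stacked₁ in
             same ,
             cell-at v ρ (ready-kept ready keeps′) counter′ ,
             decides-×¬
               (decides-×
                 (decides-resp (cong₂ (λ a i → a i) stacked′ (element-index {σ} ready v ρ keeps′ counter′)) (holdsφ v))
                 flagged)
               (decides-resp (cong₂ (λ a i → a i) stacked′ (next-element-index {σ} ready v ρ keeps′ counter′)) (holdsψ v)))
           (runs-maximal v (ready-kept ready keeps₁)
             (λ u → decides-resp (cong₂ (λ a i → a i) stacked₁ (cong (_+ toℕ u) (cong baseᵏ keeps₁))) (holdsφ u))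
             counter rowed))) λ {τ₂} s →
     let ready₂ = ready-kept ready₁ (Sieving.keeps s)
         keeps₂ = trans (Sieving.keeps s) (Marking.keeps m)
         stacked₂ = trans (Sieving.stacked s) (Marking.stacked m) in
     runs-map
       (computed-from keeps₂ stacked₂)
       (runs-fill ready₂ (≤ᵇ⇒≤ _ _ tt) λ v {τ} f → let open Filling f in decides-map {Y = v ⊨ φ ⇝ ψ}
         (λ none → supports-if-none-violates φ ψ v (λ v → decides-stable (holdsψ v)) (λ w → none w (toℕ<n w)))
         (λ supp w _ → none-violates-if-supports φ ψ v supp w)
         (decides-resp (cong₂ (λ a i → a i) marked (cell-at v τ (ready-kept ready₂ keeps) counter))
                       (Sieving.sieved s (cell v) (Marking.marked m v (toℕ<n v))))))
    where
    cell : Fin n → ℕ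
    cell v = toℕ (cellOf v)
    cell-at : ∀ v τ → inputs τ ≡ inputs (input M s₀ α₀) → regs τ idx ≡ toℕ v → arrs τ 3 (regs τ idx) ≡ cell v
    cell-at v τ ready counter = trans (cong₂ (λ a i → a i) (cong cells ready) counter) (nth-tabulate cell v)
    time : ∀ n → suc (7 + n * 13 + suc (10 + n * (9 + suc (13 + n * 31 + 27)) + (7 + n * 43)))
               ≡ 26 + n * 106 + n * (n * 31)
    time = solve-∀

  -- Processing the code

  record Config (p t : ℕ) (σ : State) : Set where
    constructor config
    field
      ready  : Ready σ
      at-pc  : regs σ pc ≡ p
      at-top : regs σ top ≡ t

  Token : ℕ → ℕ → Set
  Token p x = p < length (tokens α₀) × nth (tokens α₀) p ≡ x

  -- 57 bounds the loop guard, fetching and dispatching the token, and moving base and top.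
  runs-step : ∀ {p t b x d c T U X σ Q} → Config p t σ → Token p x →
    instruction x ≡ replacing d c → cost d ≤ 3 → (∀ {τ} → Ready τ → t ∸ eval τ d ≡ b) →
    (∀ {τ} → Ready τ → regs τ tok ≡ x → regs τ base ≡ b → arrs τ stack ≡ arrs σ stack →
      Runs c τ T (Computed τ X)) →
    (∀ {τ} → Config (suc p) (b + n) τ → Holds τ b X → SameBelow b σ τ → Runs evaluate τ U Q) →
    Runs evaluate σ (57 + T + U) Q
  runs-step {p} {t} {b} {x} {d} {c} {T} {U} {X} {σ} (config ready at-pc at-top) (p<size , code-x)
            is-replacing cheap base≡ body next =
    runs-within time (runs-loop {P = λ τ → Config (suc p) (b + n) τ × Holds τ b X × SameBelow b σ τ}
      (subst (_≢ 0) (sym (cong₂ _∸_ (cong size ready) at-pc)) (m>n⇒m∸n≢0 p<size))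
      (runs-assign-seq (runs-assign-seq (runs-dispatch instructions {j = x} tok≡x
        (subst (λ c → Runs c τ₁ (suc (suc (suc (1 + cost d)) + suc (T + 4))) _) (sym is-replacing)
          (runs-assign-seq (runs-seq (body {τ₀} ready tok≡x base₀ refl) λ {τ} done → runs-assign
            ( config (ready-kept ready (Computed.keeps done))
                (trans (cong pcᵏ (Computed.keeps done)) (trans (+-comm _ 1) (cong suc at-pc)))
                (cong₂ _+_ (trans (cong baseᵏ (Computed.keeps done)) base₀)
                           (cong states (ready-kept ready (Computed.keeps done))))
            , subst (λ b → Holds τ b X) base₀ (Computed.holds done)
            , subst (λ b → SameBelow b σ τ) base₀ (Computed.below done))))))))
      (λ (cfg , holds , below) → next cfg holds below))
    where
    τ₁ τ₀ : State
    τ₁ = setReg (setReg σ tok (arrs σ 0 (regs σ pc))) pc (regs σ pc + 1)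
    τ₀ = setReg τ₁ base (regs τ₁ top ∸ eval τ₁ d)
    tok≡x : arrs σ 0 (regs σ pc) ≡ x
    tok≡x = trans (cong₂ (λ a i → a i) (cong program ready) at-pc) code-x
    base₀ : regs τ₀ base ≡ b
    base₀ = trans (cong (_∸ eval τ₁ d) at-top) (base≡ {τ₁} ready)
    shuffle : ∀ d T U →
      suc (3 + (suc (3 + suc (4 + (32 + suc (suc (suc (1 + d)) + suc (T + 4))))) + U)) ≡ d + (54 + T + U)
    shuffle = solve-∀
    time : suc (3 + (suc (3 + suc (4 + (32 + suc (suc (suc (1 + cost d)) + suc (T + 4))))) + U)) ≤ 57 + T + U
    time = ≤-trans (≤-reflexive (shuffle (cost d) T U)) (+-monoˡ-≤ (54 + T + U) cheap)

  Code : ℕ → List ℕ → Set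
  Code p []       = ⊤
  Code p (x ∷ xs) = Token p x × Code (suc p) xs

  code-++ : ∀ {p} xs {ys} → Code p (xs ++ ys) → Code p xs × Code (p + length xs) ys
  code-++ {p} [] {ys} code = tt , subst (λ q → Code q ys) (sym (+-identityʳ p)) code
  code-++ {p} (x ∷ xs) {ys} (token , code) with code-++ xs code
  ... | code₁ , code₂ = (token , code₁) , subst (λ q → Code q ys) (sym (+-suc p (length xs))) code₂

  code-all : ∀ p xs → (∀ i → i < length xs → Token (p + i) (nth xs i)) → Code p xs
  code-all p []       f = tt
  code-all p (x ∷ xs) f =
    subst (λ q → Token q x) (+-identityʳ p) (f 0 (s≤s z≤n)) ,
    code-all (suc p) xs (λ i i<len → subst (λ q → Token q (nth xs i)) (+-suc p i) (f (suc i) (s≤s i<len)))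

  -- One price per token fits every instruction, the quadratic part of `⇝` being charged separately.
  -- The largest coefficients that occur are 83 for the constant, 106 for n, 30 for r and 31 for n²;
  -- 200 is a common round bound.
  linear quadratic : ℕ
  linear    = 200 + n * 200 + r * 200
  quadratic = n * (n * 200)

  -- In continuation-passing style, so that the evaluations of consecutive
  -- segments of code compose although they are parts of a single while loop.
  record Evaluates (xs : List ℕ) (k : ℕ) (X : Fin n → Set) : Set₁ where
    field
      continue : ∀ {p b σ U Q} → Config p b σ → Code p xs →
        (∀ {τ} → Config (p + length xs) (b + n) τ → Holds τ b X → SameBelow b σ τ → Runs evaluate τ U Q) →
        Runs evaluate σ (length xs * linear + k * quadratic + U) Q

  open Evaluates

  evaluates-leaf : ∀ x {c T X} → instruction x ≡ replacing (lit 0) c → 57 + T ≤ linear →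
    (∀ {τ} → Ready τ → regs τ tok ≡ x → Runs c τ T (Computed τ X)) →
    Evaluates [ x ] 0 X
  continue (evaluates-leaf x is-replacing cheap body) {p} {b} {U = U} cfg (token , _) next =
    runs-within (≤-trans (+-monoˡ-≤ U cheap) (≤-reflexive (time linear U)))
      (runs-step cfg token is-replacing (≤ᵇ⇒≤ _ _ tt) (λ _ → refl)
        (λ ready tok≡x _ _ → body ready tok≡x)
        (λ {τ} cfg′ → next (subst (λ q → Config q (b + n) τ) (+-comm 1 p) cfg′)))
    where
    time : ∀ l u → l + u ≡ 1 * l + 0 + u
    time = solve-∀

  evaluates-unary : ∀ xs x {c T k X Y} → instruction x ≡ replacing (reg 0) c → 57 + T ≤ linear →
    (∀ {τ} → Ready τ → Holds τ (regs τ base) X → Runs c τ T (Computed τ Y)) →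
    Evaluates xs k X → Evaluates (xs ++ [ x ]) k Y
  continue (evaluates-unary xs x {T = T} {k} is-replacing cheap body eval-xs) {p} {b} {U = U} cfg code next =
    runs-within time
      (continue eval-xs cfg (proj₁ (code-++ xs code)) λ {τ₁} cfg₁ holds₁ below₁ →
       runs-step cfg₁ (proj₁ (proj₂ (code-++ xs code))) is-replacing (≤ᵇ⇒≤ _ _ tt)
         (λ ready → trans (cong (b + n ∸_) (cong states ready)) (m+n∸n≡m b n))
         (λ ready _ base≡b stacked → body ready
           (λ v → decides-resp (cong₂ (λ a i → a i) stacked (cong (_+ toℕ v) base≡b)) (holds₁ v)))
         (λ {τ} cfg₂ holds₂ below₂ → next
           (subst (λ q → Config q (b + n) τ)
             (trans (+-comm 1 _) (trans (+-assoc p (length xs) 1) (cong (p +_) (sym (length-++ xs))))) cfg₂)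
           holds₂
           (λ i i<b → trans (below₂ i i<b) (below₁ i i<b))))
    where
    distribute : ∀ a l s u → a * l + s + (l + u) ≡ (a + 1) * l + s + u
    distribute = solve-∀
    time : length xs * linear + k * quadratic + (57 + T + U)
         ≤ length (xs ++ [ x ]) * linear + k * quadratic + U
    time = ≤-trans (+-monoʳ-≤ (length xs * linear + k * quadratic) (+-monoˡ-≤ U cheap))
      (≤-reflexive (trans (distribute (length xs) linear (k * quadratic) U)
                          (cong (λ a → a * linear + k * quadratic + U) (sym (length-++ xs)))))

  -- The quadratic charges of the token itself are counted by `j`: one for `⇝`, none for a Boolean
  -- connective.
  evaluates-binary : ∀ xs ys x {c T j k₁ k₂ X Y Z} → instruction x ≡ replacing (reg 0 ⊕ reg 0) c →
    57 + T ≤ linear + j * quadratic →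
    (∀ {τ} → Ready τ → Holds τ (regs τ base) X → Holds τ (regs τ base + n) Y → Runs c τ T (Computed τ Z)) →
    Evaluates xs k₁ X → Evaluates ys k₂ Y → Evaluates (xs ++ ys ++ [ x ]) (j + (k₁ + k₂)) Z
  continue (evaluates-binary xs ys x {T = T} {j} {k₁} {k₂} is-replacing cheap body eval-xs eval-ys)
           {p} {b} {U = U} cfg code next =
    runs-within time
      (continue eval-xs cfg (proj₁ (code-++ xs code)) λ {τ₁} cfg₁ holds₁ below₁ →
       continue eval-ys cfg₁ (proj₁ (code-++ ys (proj₂ (code-++ xs code)))) λ {τ₂} cfg₂ holds₂ below₂ →
       runs-step cfg₂ (proj₁ (proj₂ (code-++ ys (proj₂ (code-++ xs code))))) is-replacing (≤ᵇ⇒≤ _ _ tt)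
         (λ ready → trans (cong₂ _∸_ (+-assoc b n n) (cong₂ _+_ (cong states ready) (cong states ready)))
                          (m+n∸n≡m b (n + n)))
         (λ ready _ base≡b stacked → body ready
           -- The first operand's block ends where the second begins, so evaluating the second has
           -- left it intact.
           (λ v → decides-resp
             (trans (cong₂ (λ a i → a i) stacked (cong (_+ toℕ v) base≡b)) (below₂ _ (+-monoʳ-< b (toℕ<n v))))
             (holds₁ v))
           (λ v → decides-resp (cong₂ (λ a i → a i) stacked (cong (λ i → i + n + toℕ v) base≡b)) (holds₂ v)))
         (λ {τ} cfg₃ holds₃ below₃ → next
           (subst (λ q → Config q (b + n) τ)
             (trans (shift p (length xs) (length ys)) (cong (p +_) (sym length-code))) cfg₃)
           holds₃
           (λ i i<b → trans (below₃ i i<b) (trans (below₂ i (<-≤-trans i<b (m≤m+n b n))) (below₁ i i<b)))))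
    where
    shift : ∀ p k l → suc (p + k + l) ≡ p + (k + (l + 1))
    shift = solve-∀
    length-code : length (xs ++ ys ++ [ x ]) ≡ length xs + (length ys + 1)
    length-code = trans (length-++ xs) (cong (length xs +_) (length-++ ys))
    distribute : ∀ a b j k₁ k₂ l q u → a * l + k₁ * q + (b * l + k₂ * q + (l + j * q + u))
               ≡ (a + (b + 1)) * l + (j + (k₁ + k₂)) * q + u
    distribute = solve-∀
    time : length xs * linear + k₁ * quadratic + (length ys * linear + k₂ * quadratic + (57 + T + U))
         ≤ length (xs ++ ys ++ [ x ]) * linear + (j + (k₁ + k₂)) * quadratic + U
    time = ≤-trans
      (+-monoʳ-≤ (length xs * linear + k₁ * quadratic)
        (+-monoʳ-≤ (length ys * linear + k₂ * quadratic) (+-monoˡ-≤ U cheap)))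
      (≤-reflexive (trans (distribute (length xs) (length ys) j k₁ k₂ linear quadratic U)
                          (cong (λ a → a * linear + (j + (k₁ + k₂)) * quadratic + U) (sym length-code))))

  -- Instruction budgets and induction on formulas

  time-variable : 57 + (12 + n * 43) ≤ linear
  time-variable = ≤-trans (+-mono-≤ (≤ᵇ⇒≤ 69 200 tt) (*-monoʳ-≤ n (≤ᵇ⇒≤ 43 200 tt))) (m≤m+n _ (r * 200))

  time-fill : 57 + (7 + n * 43) ≤ linear
  time-fill = ≤-trans (+-monoʳ-≤ 64 (m≤n+m (n * 43) 5)) time-variable

  time-belief : 57 + (26 + n * 56 + r * 30) ≤ linear
  time-belief = +-mono-≤ (+-mono-≤ (≤ᵇ⇒≤ 83 200 tt) (*-monoʳ-≤ n (≤ᵇ⇒≤ 56 200 tt)))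
                         (*-monoʳ-≤ r (≤ᵇ⇒≤ 30 200 tt))

  time-support : 57 + (26 + n * 106 + n * (n * 31)) ≤ linear + 1 * quadratic
  time-support = +-mono-≤
    (≤-trans (+-mono-≤ (≤ᵇ⇒≤ 83 200 tt) (*-monoʳ-≤ n (≤ᵇ⇒≤ 106 200 tt))) (m≤m+n _ (r * 200)))
    (≤-trans (*-monoʳ-≤ n (*-monoʳ-≤ n (≤ᵇ⇒≤ 31 200 tt))) (m≤m+n quadratic 0))

  is-binary : ∀ o → instruction (opCode o) ≡ binary o
  is-binary and = refl
  is-binary or  = refl
  is-binary imp = refl
  is-binary iff = refl

  evaluates-operation : ∀ xs ys o {k₁ k₂ X Y} → Evaluates xs k₁ X → Evaluates ys k₂ Y →
    Evaluates (xs ++ ys ++ [ opCode o ]) (k₁ + k₂) (λ v → ⟦ o ⟧ (X v) (Y v))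
  evaluates-operation xs ys o = evaluates-binary xs ys (opCode o) {j = 0} (is-binary o)
    (≤-trans time-fill (m≤m+n linear 0)) (λ ready → runs-operation ready o)

  evaluates-negation : ∀ xs {k X} → Evaluates xs k X → Evaluates (xs ++ [ 1 ]) k (λ v → ¬ X v)
  evaluates-negation xs = evaluates-unary xs 1 refl time-fill (λ ready → runs-negation ready)

  evaluates-form : ∀ φ → varBoundₚ φ ≤ columns₀ → Evaluates (tokensₚ φ) 0 (λ v → Trueₚ V v φ)
  evaluates-form bot _ = evaluates-leaf 0 refl time-fill (λ ready _ → runs-falsum ready)
  evaluates-form (var p) bound =
    evaluates-leaf (8 + p) refl time-variable (λ ready tok≡x → runs-variable ready bound tok≡x)
  evaluates-form (φ ⟨ o ⟩ ψ) bound = evaluates-operation (tokensₚ φ) (tokensₚ ψ) o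
    (evaluates-form φ (m⊔n≤o⇒m≤o (varBoundₚ φ) _ bound))
    (evaluates-form ψ (m⊔n≤o⇒n≤o (varBoundₚ φ) _ bound))
  evaluates-form (neg φ) bound = evaluates-negation (tokensₚ φ) (evaluates-form φ bound)

  -- The valuation table keeps the width fixed by `α₀` while the induction descends to subformulas;
  -- the bound ensures that each variable met has a column.
  evaluates : ∀ α → varBound α ≤ columns₀ → Evaluates (tokens α) (supports α) (λ v → v ⊨ α)
  evaluates (prop φ) bound = evaluates-form φ bound
  evaluates (φ ⇝ ψ) bound =
    evaluates-binary (tokensₚ φ) (tokensₚ ψ) 6 {j = 1} refl time-support (λ ready → runs-support φ ψ ready)
      (evaluates-form φ (m⊔n≤o⇒m≤o (varBoundₚ φ) _ bound))
      (evaluates-form ψ (m⊔n≤o⇒n≤o (varBoundₚ φ) _ bound))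
  evaluates (B α) bound =
    evaluates-unary (tokens α) 7 refl time-belief (λ ready → runs-belief ready) (evaluates α bound)
  evaluates (α ⟨ o ⟩ β) bound = evaluates-operation (tokens α) (tokens β) o
    (evaluates α (m⊔n≤o⇒m≤o (varBound α) _ bound))
    (evaluates β (m⊔n≤o⇒n≤o (varBound α) _ bound))
  evaluates (neg α) bound = evaluates-negation (tokens α) (evaluates α bound)

  runs-evaluation :
    Runs (assign pc (lit 0) ⨾ assign top (lit 0) ⨾ evaluate ⨾ assign 0 (load stack (reg 3))) (input M s₀ α₀)
         (14 + (length (tokens α₀) * linear + supports α₀ * quadratic))
         (λ τ → Decides (output τ) (s₀ ⊨ α₀))
  runs-evaluation = runs-within (≤-reflexive (time (length (tokens α₀) * linear + supports α₀ * quadratic)))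
    (runs-assign-seq (runs-assign-seq (runs-seq
      {P = λ τ → Decides (eval τ (load stack (reg 3))) (s₀ ⊨ α₀)}
      (continue (evaluates α₀ ≤-refl) (config refl refl refl) (code-all 0 (tokens α₀) (λ i i<len → i<len , refl))
        λ {τ} cfg holds _ → let open Config cfg in
        runs-exit (trans (cong₂ _∸_ (cong size ready) at-pc) (n∸n≡0 (length (tokens α₀))))
                  (decides-resp (cong (arrs τ stack) (cong start ready)) (holds s₀)))
      runs-assign)))
    where
    time : ∀ t → suc (2 + suc (2 + suc (t + 4 + 3))) ≡ 14 + t
    time = solve-∀

-- Counting tokens

tokensₚ-nonempty : ∀ φ → 1 ≤ length (tokensₚ φ)
tokensₚ-nonempty bot         = s≤s z≤n
tokensₚ-nonempty (var p)     = s≤s z≤n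
tokensₚ-nonempty (φ ⟨ o ⟩ ψ) =
  subst (1 ≤_) (sym (length-++ (tokensₚ φ))) (≤-trans (tokensₚ-nonempty φ) (m≤m+n _ _))
tokensₚ-nonempty (neg φ)     =
  subst (1 ≤_) (sym (length-++ (tokensₚ φ))) (≤-trans (tokensₚ-nonempty φ) (m≤m+n _ _))

tokens-nonempty : ∀ α → 1 ≤ length (tokens α)
tokens-nonempty (prop φ)    = tokensₚ-nonempty φ
tokens-nonempty (φ ⇝ ψ)     =
  subst (1 ≤_) (sym (length-++ (tokensₚ φ))) (≤-trans (tokensₚ-nonempty φ) (m≤m+n _ _))
tokens-nonempty (B α)       =
  subst (1 ≤_) (sym (length-++ (tokens α))) (≤-trans (tokens-nonempty α) (m≤m+n _ _))
tokens-nonempty (α ⟨ o ⟩ β) =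
  subst (1 ≤_) (sym (length-++ (tokens α))) (≤-trans (tokens-nonempty α) (m≤m+n _ _))
tokens-nonempty (neg α)     =
  subst (1 ≤_) (sym (length-++ (tokens α))) (≤-trans (tokens-nonempty α) (m≤m+n _ _))

-- As `⊥` has one token and weight 0, each code is granted one token free of charge. An operator of
-- weight 1 pays for two: its own token and the surplus from merging two grants into one.
length-binary-≤ : ∀ xs ys (x : ℕ) a b → length xs ≤ suc (2 * a) → length ys ≤ suc (2 * b) →
                  length (xs ++ ys ++ [ x ]) ≤ suc (2 * suc (a + b))
length-binary-≤ xs ys x a b xs≤ ys≤ = begin
  length (xs ++ ys ++ [ x ])           ≡⟨ trans (length-++ xs) (cong (length xs +_) (length-++ ys)) ⟩
  length xs + (length ys + 1)          ≤⟨ +-mono-≤ xs≤ (+-monoˡ-≤ 1 ys≤) ⟩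
  suc (2 * a) + (suc (2 * b) + 1)      ≡⟨ regroup a b ⟩
  suc (2 * suc (a + b))                ∎
  where
  open ≤-Reasoning
  regroup : ∀ a b → suc (2 * a) + (suc (2 * b) + 1) ≡ suc (2 * suc (a + b))
  regroup = solve-∀

length-unary-≤ : ∀ xs (x : ℕ) {a} → length xs ≤ suc (2 * a) → length (xs ++ [ x ]) ≤ suc (2 * suc a)
length-unary-≤ xs x {a} xs≤ = begin
  length (xs ++ [ x ])    ≡⟨ length-++ xs ⟩
  length xs + 1           ≤⟨ +-monoˡ-≤ 1 xs≤ ⟩
  suc (2 * a) + 1         ≤⟨ n≤1+n _ ⟩
  suc (suc (2 * a) + 1)   ≡⟨ regroup a ⟩
  suc (2 * suc a)         ∎
  where
  open ≤-Reasoning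
  regroup : ∀ a → suc (suc (2 * a) + 1) ≡ suc (2 * suc a)
  regroup = solve-∀

weightₚ : Form → ℕ
weightₚ φ = atomsₚ φ + connectivesₚ φ

weight : TForm → ℕ
weight α = supports α + (beliefs α + atoms α + connectives α)

length-tokensₚ : ∀ φ → length (tokensₚ φ) ≤ suc (2 * weightₚ φ)
length-tokensₚ bot         = s≤s z≤n
length-tokensₚ (var p)     = s≤s z≤n
length-tokensₚ (φ ⟨ o ⟩ ψ) =
  subst (λ w → length (tokensₚ (φ ⟨ o ⟩ ψ)) ≤ suc (2 * w))
    (regroup (atomsₚ φ) (atomsₚ ψ) (connectivesₚ φ) (connectivesₚ ψ))
    (length-binary-≤ (tokensₚ φ) (tokensₚ ψ) (opCode o) (weightₚ φ) (weightₚ ψ)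
      (length-tokensₚ φ) (length-tokensₚ ψ))
  where
  regroup : ∀ a b c d → suc (a + c + (b + d)) ≡ a + b + suc (c + d)
  regroup = solve-∀
length-tokensₚ (neg φ)     =
  subst (λ w → length (tokensₚ (neg φ)) ≤ suc (2 * w)) (sym (+-suc (atomsₚ φ) (connectivesₚ φ)))
    (length-unary-≤ (tokensₚ φ) 1 (length-tokensₚ φ))

weight-⇝ : ∀ φ ψ → weight (φ ⇝ ψ) ≡ suc (weightₚ φ + weightₚ ψ)
weight-⇝ φ ψ = regroup (atomsₚ φ) (atomsₚ ψ) (connectivesₚ φ) (connectivesₚ ψ)
  where
  regroup : ∀ a b c d → suc (a + b + (c + d)) ≡ suc (a + c + (b + d))
  regroup = solve-∀

weight-B : ∀ α → weight (B α) ≡ suc (weight α)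
weight-B α = +-suc (supports α) _

weight-op : ∀ α o β → weight (α ⟨ o ⟩ β) ≡ suc (weight α + weight β)
weight-op α o β = regroup (supports α) (supports β) (beliefs α) (beliefs β)
                          (atoms α) (atoms β) (connectives α) (connectives β)
  where
  regroup : ∀ s s′ b b′ a a′ c c′ →
    s + s′ + (b + b′ + (a + a′) + suc (c + c′)) ≡ suc (s + (b + a + c) + (s′ + (b′ + a′ + c′)))
  regroup = solve-∀

weight-neg : ∀ α → weight (neg α) ≡ suc (weight α)
weight-neg α = trans (cong (supports α +_) (+-suc (beliefs α + atoms α) _)) (+-suc (supports α) _)

length-tokens : ∀ α → length (tokens α) ≤ suc (2 * weight α)
length-tokens (prop φ)    = length-tokensₚ φ
length-tokens (φ ⇝ ψ)     =
  subst (λ w → length (tokens (φ ⇝ ψ)) ≤ suc (2 * w)) (sym (weight-⇝ φ ψ))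
    (length-binary-≤ (tokensₚ φ) (tokensₚ ψ) 6 (weightₚ φ) (weightₚ ψ)
      (length-tokensₚ φ) (length-tokensₚ ψ))
length-tokens (B α)       =
  subst (λ w → length (tokens (B α)) ≤ suc (2 * w)) (sym (weight-B α))
    (length-unary-≤ (tokens α) 7 (length-tokens α))
length-tokens (α ⟨ o ⟩ β) =
  subst (λ w → length (tokens (α ⟨ o ⟩ β)) ≤ suc (2 * w)) (sym (weight-op α o β))
    (length-binary-≤ (tokens α) (tokens β) (opCode o) (weight α) (weight β)
      (length-tokens α) (length-tokens β))
length-tokens (neg α)     =
  subst (λ w → length (tokens (neg α)) ≤ suc (2 * w)) (sym (weight-neg α))
    (length-unary-≤ (tokens α) 1 (length-tokens α))

-- The exceptional formula ⊥ and the overall bound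

NonTrivial : TForm → Set
NonTrivial α = length (tokens α) ∸ 1 + nth (tokens α) 0 ≢ 0 × 1 ≤ weight α

long⇒nontrivial : ∀ α xs ys {w} → tokens α ≡ xs ++ ys → 1 ≤ length xs → 1 ≤ length ys →
                  weight α ≡ suc w → NonTrivial α
long⇒nontrivial α xs ys code 1≤xs 1≤ys weight≡ =
  m+n≢0 (m>n⇒m∸n≢0 (subst (1 <_) (sym (trans (cong length code) (length-++ xs))) (+-mono-≤ 1≤xs 1≤ys))) ,
  subst (1 ≤_) (sym weight≡) (s≤s z≤n)
  where
  m+n≢0 : ∀ {m n} → m ≢ 0 → m + n ≢ 0
  m+n≢0 {m} m≢0 m+n≡0 = m≢0 (m+n≡0⇒m≡0 m m+n≡0)

1≤length-snoc : ∀ (xs : List ℕ) x → 1 ≤ length (xs ++ [ x ])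
1≤length-snoc xs x = subst (1 ≤_) (sym (length-++ xs)) (m≤n+m 1 (length xs))

-- The first half of `NonTrivial` sends `checker` into its general branch; the second lets the
-- weight absorb additive constants in `total-time`. Both fail for `prop bot`.
trivial⊎nontrivial : ∀ α → α ≡ prop bot ⊎ NonTrivial α
trivial⊎nontrivial (prop bot)          = inj₁ refl
trivial⊎nontrivial (prop (var p))      = inj₂ ((λ ()) , s≤s z≤n)
trivial⊎nontrivial (prop (φ ⟨ o ⟩ ψ))  = inj₂ (long⇒nontrivial (prop (φ ⟨ o ⟩ ψ)) (tokensₚ φ) (tokensₚ ψ ++ [ opCode o ]) refl
  (tokensₚ-nonempty φ) (1≤length-snoc (tokensₚ ψ) (opCode o)) (+-suc (atomsₚ φ + atomsₚ ψ) _))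
trivial⊎nontrivial (prop (neg φ))      = inj₂ (long⇒nontrivial (prop (neg φ)) (tokensₚ φ) [ 1 ] refl
  (tokensₚ-nonempty φ) ≤-refl (+-suc (atomsₚ φ) _))
trivial⊎nontrivial (φ ⇝ ψ)             = inj₂ (long⇒nontrivial (φ ⇝ ψ) (tokensₚ φ) (tokensₚ ψ ++ [ 6 ]) refl
  (tokensₚ-nonempty φ) (1≤length-snoc (tokensₚ ψ) 6) (weight-⇝ φ ψ))
trivial⊎nontrivial (B α)               = inj₂ (long⇒nontrivial (B α) (tokens α) [ 7 ] refl
  (tokens-nonempty α) ≤-refl (weight-B α))
trivial⊎nontrivial (α ⟨ o ⟩ β)         = inj₂ (long⇒nontrivial (α ⟨ o ⟩ β) (tokens α) (tokens β ++ [ opCode o ]) refl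
  (tokens-nonempty α) (1≤length-snoc (tokens β) (opCode o)) (weight-op α o β))
trivial⊎nontrivial (neg α)             = inj₂ (long⇒nontrivial (neg α) (tokens α) [ 1 ] refl
  (tokens-nonempty α) ≤-refl (weight-neg α))

-- As `w` and `n + r` are at least 1, they absorb all constants: the code has at most 3w tokens,
-- each costing at most 400 (n + r). With 21 for the initial test, the set-up and reading the
-- answer, the coefficient is 1221, rounded up to 1300.
total-time : ∀ n r k {w ℓ C} → 1300 ≤ C → 1 ≤ n → 1 ≤ w → ℓ ≤ suc (2 * w) →
  21 + (ℓ * (200 + n * 200 + r * 200) + k * (n * (n * 200))) ≤ C * (1 ⊔ (k * n ^ 2 + w * (n + r)))
total-time n r k {w} {ℓ} {C} 1300≤C 1≤n 1≤w ℓ≤ = begin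
  21 + (ℓ * (200 + n * 200 + r * 200) + k * (n * (n * 200)))
    ≤⟨ +-mono-≤ (*-monoˡ-≤ 21 (*-mono-≤ 1≤w 1≤n+r))
                (+-mono-≤ (*-mono-≤ ℓ≤w*3 linear≤) (≤-reflexive (square k n 200))) ⟩
  y * 21 + (w * 3 * ((n + r) * 400) + z * 200)
    ≡⟨ cong (λ x → y * 21 + (x + z * 200)) ([m*n]*[o*p]≡[m*o]*[n*p] w 3 (n + r) 400) ⟩
  y * 21 + (y * 1200 + z * 200)
    ≡⟨ collect y z 21 1200 200 ⟩
  z * 200 + y * 1221
    ≤⟨ +-mono-≤ (*-monoʳ-≤ z (≤ᵇ⇒≤ 200 1300 tt)) (*-monoʳ-≤ y (≤ᵇ⇒≤ 1221 1300 tt)) ⟩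
  z * 1300 + y * 1300
    ≡⟨ *-distribʳ-+ 1300 z y ⟨
  (z + y) * 1300
    ≤⟨ *-mono-≤ (m≤n⊔m 1 (z + y)) 1300≤C ⟩
  (1 ⊔ (z + y)) * C
    ≡⟨ *-comm (1 ⊔ (z + y)) C ⟩
  C * (1 ⊔ (z + y)) ∎
  where
  open ≤-Reasoning
  y z : ℕ
  y = w * (n + r)
  z = k * n ^ 2
  1≤n+r : 1 ≤ n + r
  1≤n+r = ≤-trans 1≤n (m≤m+n n r)
  ℓ≤w*3 : ℓ ≤ w * 3
  ℓ≤w*3 = ≤-trans ℓ≤ (≤-trans (+-monoˡ-≤ (2 * w) 1≤w) (≤-reflexive (*-comm 3 w)))
  square : ∀ k n c → k * (n * (n * c)) ≡ k * (n * (n * 1)) * c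
  square = solve-∀
  double : ∀ n r c → (n + r) * c + n * c + r * c ≡ (n + r) * (c + c)
  double = solve-∀
  collect : ∀ y z a b c → y * a + (y * b + z * c) ≡ z * c + y * (a + b)
  collect = solve-∀
  linear≤ : 200 + n * 200 + r * 200 ≤ (n + r) * 400
  linear≤ = ≤-trans (+-monoˡ-≤ (r * 200) (+-monoˡ-≤ (n * 200) (*-monoˡ-≤ 200 1≤n+r)))
                    (≤-reflexive (double n r 200))

checker-runs : ∀ M (s : Fin (FiniteTrustModel.n M)) α {C} → 1300 ≤ C → let open FiniteTrustModel M in
  Runs checker (input M s α) (C * (1 ⊔ (supports α * n ^ 2 + weight α * (n + r))))
       (λ τ → Decides (output τ) (s ⊨ α))
checker-runs M s α {C} 1300≤C with trivial⊎nontrivial α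
... | inj₁ refl = runs-within
  -- For ⊥ the test costs 7 and the assignment 2, while k and k′ are 0; the `1 ⊔` in the bound
  -- leaves room for them.
  (≤-trans (≤-trans (≤ᵇ⇒≤ 9 1300 tt) 1300≤C) (≤-trans (≤-reflexive (sym (*-identityʳ C))) (*-monoʳ-≤ C (m≤m⊔n 1 0))))
  (runs-else refl (runs-assign (inj₂ (refl , λ ()))))
... | inj₂ (long , 1≤weight) = runs-within
  (total-time n r (supports α) {ℓ = length (tokens α)}
    1300≤C (≤-trans (s≤s z≤n) (toℕ<n s)) 1≤weight (length-tokens α))
  (runs-then long (Evaluation.runs-evaluation M s α))
  where open FiniteTrustModel M

theorem7 :
    ∃ λ (P : Prog) → ∃ λ (C : ℕ) →
      (M : FiniteTrustModel) → let open FiniteTrustModel M in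
      (s : Fin n) (α : TForm) →
      let k  = supports α
          k′ = beliefs α + atoms α + connectives α
      in
      ∃ λ (σ : State) → ∃ λ (t : ℕ) →
        (P , input M s α ⇓ σ , t)
        × t ≤ C * (1 ⊔ (k * n ^ 2 + (k + k′) * (n + r)))
        × Decides (output σ) (s ⊨ α)
theorem7 = checker , 1300 , λ M s α → let open Runs (checker-runs M s α ≤-refl) in
  final , time , run , time≤ , post
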